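{- For every positive integer $k$, $11\log(k)$ is a $k$-feasible constant; that is, every $k$-multiple tree $G$ has a spanning tree factorization $(T_1,\ldots,T_k)$ such that $|d_{T_i}(v)-\frac{d_G(v)}{k}|\leq 11\log(k)$ for all $v\in V(G)$ and $i\in\{1,\ldots,k\}$.
   Context: Graphs are finite and may have parallel edges. For a positive integer $k$, a graph $G$ is a $k$-multiple tree if there are spanning trees $T_1,\ldots,T_k$ of $G$ that are pairwise edge-disjoint and satisfy $E(T_1)\cup\cdots\cup E(T_k)=E(G)$; the tuple $(T_1,\ldots,T_k)$ is then called a spanning tree factorization of $G$. $d_H(v)$ denotes the number of edges of $H$ incident to $v$. A real constant $c_k$ is $k$-feasible if every $k$-multiple tree $G$ has a spanning tree factorization $(T_1,\ldots,T_k)$ with $|d_{T_i}(v)-\frac{d_G(v)}{k}|\leq c_k$ for all $v\in V(G)$, $i\in\{1,\ldots,k\}$. $\log$ is the logarithm to base $2$. -}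

module Defs where

open import Data.Nat using (ℕ; zero; suc; _+_; _*_; _^_; _≤_; ∣_-_∣)
open import Data.Fin using (Fin; _≟_)
open import Data.Bool using (Bool; true; false; if_then_else_; _∧_; _∨_)
open import Data.Product using (_×_; proj₁; proj₂; ∃)
open import Data.List using (map; allFin)
open import Data.Nat.ListAction using (sum)
open import Relation.Nullary using (¬_)
open import Relation.Nullary.Decidable using (⌊_⌋)
open import Relation.Binary.PropositionalEquality using (_≡_; _≢_)

record Graph : Set where
  field
    n    : ℕ
    m    : ℕ
    ends : Fin m → Fin n × Fin n

open Graph public

EdgeSet : Graph → Set
EdgeSet G = Fin (m G) → Bool

allEdges : (G : Graph) → EdgeSet G
allEdges G e = true

without : (G : Graph) → EdgeSet G → Fin (m G) → EdgeSet G
without G S e f = if ⌊ e ≟ f ⌋ then false else S f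

data Reach (G : Graph) (S : EdgeSet G) : Fin (n G) → Fin (n G) → Set where
  here  : ∀ {u} → Reach G S u u
  stepF : ∀ {u w} (e : Fin (m G)) → S e ≡ true →
          proj₁ (ends G e) ≡ u → Reach G S (proj₂ (ends G e)) w → Reach G S u w
  stepB : ∀ {u w} (e : Fin (m G)) → S e ≡ true →
          proj₂ (ends G e) ≡ u → Reach G S (proj₁ (ends G e)) w → Reach G S u w

Connected : (G : Graph) → EdgeSet G → Set
Connected G S = ∀ u v → Reach G S u v

-- Acyclic: no edge of S lies on a cycle of S, i.e. the endpoints of every
-- edge e of S are not joined by a walk in S − e (this excludes loops and
-- parallel edges within S).
Acyclic : (G : Graph) → EdgeSet G → Set
Acyclic G S = ∀ e → S e ≡ true →
  ¬ Reach G (without G S e) (proj₁ (ends G e)) (proj₂ (ends G e))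

SpanningTree : (G : Graph) → EdgeSet G → Set
SpanningTree G S = Connected G S × Acyclic G S

IsFactorization : (k : ℕ) (G : Graph) → (Fin k → EdgeSet G) → Set
IsFactorization k G T =
  (∀ i → SpanningTree G (T i)) ×
  (∀ i j e → i ≢ j → T i e ≡ true → T j e ≡ true → Data.Empty.⊥) ×
  (∀ e → ∃ λ i → T i e ≡ true)
  where import Data.Empty

MultipleTree : ℕ → Graph → Set
MultipleTree k G = ∃ λ (T : Fin k → EdgeSet G) → IsFactorization k G T

deg : (G : Graph) → EdgeSet G → Fin (n G) → ℕ
deg G H v = sum (map (λ e → if H e ∧ (⌊ proj₁ (ends G e) ≟ v ⌋ ∨ ⌊ proj₂ (ends G e) ≟ v ⌋)
                               then 1 else 0) (allFin (m G)))

-- |d_T(v) − d_G(v)/k| ≤ 11·log₂ k, rewritten exactly (for k ≥ 1) as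
-- |k·d_T(v) − d_G(v)| ≤ 11·k·log₂ k, i.e. 2^|k·d_T(v) − d_G(v)| ≤ k^(11k).
WithinBound : (k dT dG : ℕ) → Set
WithinBound k dT dG = 2 ^ ∣ k * dT - dG ∣ ≤ k ^ (11 * k)

{-# OPTIONS --safe #-}

-- Call two trees balanced if their degrees differ by at most 6 at every vertex.
-- The union of two spanning trees of n vertices can always be refactored into
-- balanced ones, by induction on n. A vertex of degree at most 8 is never a
-- problem, as each tree uses at least one of its edges; call it light. The
-- graph has 2(n - 1) edges, so the charges 2 deg v - 8 have negative sum. If no
-- vertex of degree 2 has a light neighbour, no vertex has two neighbours of
-- degree 2 and every vertex of degree 3 has two heavy neighbours, then heavy
-- vertices can pay for the vertices of degree 2 and 3, which is impossible.
-- Otherwise the graph can be reduced to a smaller one.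
--
-- For k trees, let f be the deviation from the mean. Two levelled families of
-- a trees are levelled jointly by balancing their members in pairs, at the
-- cost f + 3. An additional tree is included at the cost f + 6, by repeatedly
-- balancing it with one of the others and levelling these again: its distance
-- from their mean is roughly halved each time. Hence f <= 9 log k.

module Submission where

open import Defs
open import Data.Bool using (Bool; true; false; not; if_then_else_; _∧_; _∨_)
import Data.Bool.Properties as Boolₚ
open import Data.Fin using (Fin; _≟_)
open import Data.List using (List; []; _∷_; _++_; length; map; allFin; filter)
import Data.List.Membership.DecPropositional as DecMembership
open import Data.List.Membership.Propositional using (_∈_; _∉_)
open import Data.List.Membership.Propositional.Properties
  using (∈-allFin; ∈-filter⁺; ∈-filter⁻; ∈-map⁺; ∈-∃++)
open import Data.List.Properties using (length-map; length-tabulate)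
open import Data.List.Relation.Binary.Permutation.Propositional
  using (_↭_; ↭-refl; ↭-sym; ↭-trans; ↭⇒↭ₛ; prep; swap)
open import Data.List.Relation.Binary.Permutation.Propositional.Properties
  using (∈-resp-↭; ↭-length; shift)
import Data.List.Relation.Binary.Permutation.Setoid.Properties as Permₛ
open import Data.List.Relation.Unary.All using (All; []; _∷_)
import Data.List.Relation.Unary.All as All
open import Data.List.Relation.Unary.AllPairs using ([]; _∷_)
import Data.List.Relation.Unary.AllPairs as AllPairs
open import Data.List.Relation.Unary.Any using (here; there)
open import Data.List.Relation.Unary.Unique.Propositional using (Unique)
open import Data.List.Relation.Unary.Unique.Propositional.Properties using (allFin⁺; filter⁺)
open import Data.Nat using (ℕ; zero; suc; _+_; _*_; _^_; _≤_; _<_; _≥_; _≤?_; z≤n; s≤s; ∣_-_∣)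
open import Data.Nat.ListAction using (sum)
open import Data.Nat.Properties hiding (_≟_)
open import Data.Nat.Tactic.RingSolver using (solve-∀)
open import Data.Product using (_×_; _,_; proj₁; proj₂; ∃; ∃₂)
open import Data.Sum using (_⊎_; inj₁; inj₂; [_,_]′)
import Data.Sum as Sum
open import Function using (_∘_; id)
open import Relation.Binary.Construct.Closure.ReflexiveTransitive
  using (Star; ε; _◅_; _◅◅_; kleisliStar; return; reverse)
open import Relation.Binary.Definitions using (DecidableEquality)
open import Relation.Binary.PropositionalEquality
open import Relation.Nullary using (¬_; Dec; yes; no; contradiction)
open import Relation.Nullary.Decidable using (⌊_⌋)
open import Algebra.Properties.CommutativeSemigroup +-commutativeSemigroup
  using (x∙yz≈y∙xz; interchange)

-- The induction hypothesis says nothing about which colours it uses on the smaller graph, so the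
-- edges put back must suit every outcome. Light vertices need no care; a heavy one must see its
-- difference unchanged or receive a single new edge whose colour can be chosen. The two edges at a
-- vertex of degree 2 have different colours, which leaves one binary choice: it can favour one
-- heavy neighbour but not two. This is why vertices of degree 2 with two heavy neighbours are left
-- to the discharging.
--
-- The constants fit together. Degree 8 with an edge of each colour gives a difference of at most 8
-- - 2 = 6. A heavy vertex of degree d pays at most d + 1, and d + 1 <= 2d - 8 holds from d = 9 on.
-- In the levelling, a difference of 6 is a distance of 3 from the mean of a pair.
--
-- Acyclicity is not carried through the construction. Classes that connect all vertices and have at
-- most n - 1 edges each are trees, so connectedness and edge counts are maintained and acyclicity
-- is recovered at the end.

Σ : {A : Set} → (A → ℕ) → List A → ℕ
Σ f V = sum (map f V)

Σ-+ : ∀ {A : Set} (f g : A → ℕ) V → Σ (λ v → f v + g v) V ≡ Σ f V + Σ g V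
Σ-+ f g []      = refl
Σ-+ f g (v ∷ V) = trans (cong (f v + g v +_) (Σ-+ f g V)) (interchange (f v) (g v) (Σ f V) (Σ g V))

Σ-mono : ∀ {A : Set} {f g : A → ℕ} V → All (λ v → f v ≤ g v) V → Σ f V ≤ Σ g V
Σ-mono []      []       = z≤n
Σ-mono (v ∷ V) (h ∷ hs) = +-mono-≤ h (Σ-mono V hs)

Σ-const : ∀ {A : Set} k (V : List A) → Σ (λ _ → k) V ≡ k * length V
Σ-const k []      = sym (*-zeroʳ k)
Σ-const k (v ∷ V) = trans (cong (k +_) (Σ-const k V)) (sym (*-suc k (length V)))

Σ-* : ∀ {A : Set} k (f : A → ℕ) V → Σ (λ v → k * f v) V ≡ k * Σ f V
Σ-* k f []      = sym (*-zeroʳ k)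
Σ-* k f (v ∷ V) = trans (cong (k * f v +_) (Σ-* k f V)) (sym (*-distribˡ-+ k (f v) (Σ f V)))

Σ-cong : ∀ {A : Set} {f g : A → ℕ} V → (∀ {v} → v ∈ V → f v ≡ g v) → Σ f V ≡ Σ g V
Σ-cong []      eq = refl
Σ-cong (v ∷ V) eq = cong₂ _+_ (eq (here refl)) (Σ-cong V (eq ∘ there))

Σ-swap : ∀ {A B : Set} (f : A → B → ℕ) U V →
         Σ (λ u → Σ (f u) V) U ≡ Σ (λ v → Σ (λ u → f u v) U) V
Σ-swap f []      V = sym (Σ-const 0 V)
Σ-swap f (u ∷ U) V = trans (cong (Σ (f u) V +_) (Σ-swap f U V)) (sym (Σ-+ (f u) _ V))

-- Indicators of a vertex and identification of two vertices

module Points {A : Set} (_≟_ : DecidableEquality A) where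

  on : A → A → ℕ → ℕ
  on x v k with x ≟ v
  ... | yes _ = k
  ... | no  _ = 0

  on-refl : ∀ v {k} → on v v k ≡ k
  on-refl v with v ≟ v
  ... | yes _  = refl
  ... | no v≢v = contradiction refl v≢v

  on-≢ : ∀ {x v k} → x ≢ v → on x v k ≡ 0
  on-≢ {x} {v} x≢v with x ≟ v
  ... | yes x≡v = contradiction x≡v x≢v
  ... | no  _   = refl

  on-mono : ∀ x v {k l} → (x ≡ v → k ≤ l) → on x v k ≤ on x v l
  on-mono x v le with x ≟ v
  ... | yes x≡v = le x≡v
  ... | no  _   = z≤n

  on-+ : ∀ x v k l → on x v (k + l) ≡ on x v k + on x v l
  on-+ x v k l with x ≟ v
  ... | yes _ = refl
  ... | no  _ = refl

  Σ-on-∉ : ∀ x k V → All (λ v → x ≢ v) V → Σ (λ v → on x v k) V ≡ 0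
  Σ-on-∉ x k []      []         = refl
  Σ-on-∉ x k (v ∷ V) (x≢v ∷ ne) rewrite on-≢ {k = k} x≢v = Σ-on-∉ x k V ne

  Σ-on : ∀ {x V} k → Unique V → x ∈ V → Σ (λ v → on x v k) V ≡ k
  Σ-on {x} {v ∷ V} k (ne ∷ un) (here refl)
    = trans (cong₂ _+_ (on-refl x) (Σ-on-∉ x k V ne)) (+-identityʳ k)
  Σ-on {x} {v ∷ V} k (ne ∷ un) (there x∈)
    rewrite on-≢ {k = k} (≢-sym (All.lookup ne x∈)) = Σ-on k un x∈

  -- The vertex map of contracting `b` into `a`; the contraction arguments push walks through it.
  glue : A → A → A → A
  glue a b u with u ≟ b
  ... | yes _ = a
  ... | no  _ = u

  glue-≢ : ∀ {a b u} → u ≢ b → glue a b u ≡ u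
  glue-≢ {a} {b} {u} u≢b with u ≟ b
  ... | yes u≡b = contradiction u≡b u≢b
  ... | no  _   = refl

  glue-a : ∀ a b → glue a b a ≡ a
  glue-a a b with a ≟ b
  ... | yes _ = refl
  ... | no  _ = refl

  glue-b : ∀ a b → glue a b b ≡ a
  glue-b a b with b ≟ b
  ... | yes _  = refl
  ... | no b≢b = contradiction refl b≢b

col : Bool → Bool → ℕ
col true  true  = 1
col false false = 1
col true  false = 0
col false true  = 0

col-sum : ∀ d → col true d + col false d ≡ 1
col-sum true  = refl
col-sum false = refl

col-refl : ∀ c → col c c ≡ 1
col-refl true  = refl
col-refl false = refl

≢⇒≡not : ∀ {c d} → c ≢ d → d ≡ not c
≢⇒≡not {true}  {true}  ne = contradiction refl ne
≢⇒≡not {true}  {false} ne = refl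
≢⇒≡not {false} {true}  ne = refl
≢⇒≡not {false} {false} ne = contradiction refl ne

not≢ : ∀ c → not c ≢ c
not≢ true  ()
not≢ false ()

-- Two-coloured multigraphs as lists of edges

module TwoTrees {A : Set} (_≟_ : DecidableEquality A) where

  open Points _≟_

  Edge : Set
  Edge = Bool × A × A

  Weight : Set
  Weight = Bool → A → A → ℕ

  -- A sum over half-edges at v; a loop counts twice.
  W : Weight → List Edge → A → ℕ
  W g []                v = 0
  W g ((c , x , y) ∷ L) v = on x v (g c x y) + on y v (g c y x) + W g L v

  one : Weight
  one _ _ _ = 1

  degree : List Edge → A → ℕ
  degree = W one

  cdeg : Bool → List Edge → A → ℕ
  cdeg c = W (λ d _ _ → col c d)

  W-mono : ∀ {g h} L v → (∀ c y → g c v y ≤ h c v y) → W g L v ≤ W h L v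
  W-mono [] v le = z≤n
  W-mono ((c , x , y) ∷ L) v le =
    +-mono-≤ (+-mono-≤ (on-mono x v λ { refl → le c y }) (on-mono y v λ { refl → le c x }))
             (W-mono L v le)

  interchange₃ : ∀ a b c d e f → a + b + (c + d) + (e + f) ≡ a + c + e + (b + d + f)
  interchange₃ = solve-∀

  W-+ : ∀ g h L v → W (λ c x y → g c x y + h c x y) L v ≡ W g L v + W h L v
  W-+ g h [] v = refl
  W-+ g h ((c , x , y) ∷ L) v
    rewrite on-+ x v (g c x y) (h c x y) | on-+ y v (g c y x) (h c y x) | W-+ g h L v =
    interchange₃ (on x v (g c x y)) (on x v (h c x y)) (on y v (g c y x)) (on y v (h c y x))
                 (W g L v) (W h L v)

  W-zero : ∀ {g} L v → (∀ c y → g c v y ≡ 0) → W g L v ≡ 0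
  W-zero {g} L v eq = n≤0⇒n≡0 (≤-trans (W-mono L v (λ c y → ≤-reflexive (eq c y))) (≤-reflexive (zeros L)))
    where
    zeros : ∀ L → W (λ _ _ _ → 0) L v ≡ 0
    zeros [] = refl
    zeros ((c , x , y) ∷ L) with x ≟ v | y ≟ v
    ... | yes _ | yes _ = zeros L
    ... | yes _ | no  _ = zeros L
    ... | no  _ | yes _ = zeros L
    ... | no  _ | no  _ = zeros L

  deg-split : ∀ L v → degree L v ≡ cdeg true L v + cdeg false L v
  deg-split L v = trans (≤-antisym
      (W-mono L v (λ c _ → ≤-reflexive (sym (col-sum c))))
      (W-mono L v (λ c _ → ≤-reflexive (col-sum c))))
    (W-+ _ _ L v)

  infix 4 _≈_

  -- The same multigraph: edges may be reordered and reversed, colours stay. It serves to bring the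
  -- edges at a vertex to the front, written from that vertex.
  data _≈_ : List Edge → List Edge → Set where
    []      : [] ≈ []
    prep    : ∀ e {L M} → L ≈ M → e ∷ L ≈ e ∷ M
    flip    : ∀ c x y {L M} → L ≈ M → (c , x , y) ∷ L ≈ (c , y , x) ∷ M
    swap    : ∀ e f {L M} → L ≈ M → e ∷ f ∷ L ≈ f ∷ e ∷ M
    ≈-trans : ∀ {L M N} → L ≈ M → M ≈ N → L ≈ N

  ≈-refl : ∀ {L} → L ≈ L
  ≈-refl {[]}    = []
  ≈-refl {e ∷ L} = prep e ≈-refl

  ≈-sym : ∀ {L M} → L ≈ M → M ≈ L
  ≈-sym []             = []
  ≈-sym (prep e p)     = prep e (≈-sym p)
  ≈-sym (flip c x y p) = flip c y x (≈-sym p)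
  ≈-sym (swap e f p)   = swap f e (≈-sym p)
  ≈-sym (≈-trans p q)  = ≈-trans (≈-sym q) (≈-sym p)

  ≈-length : ∀ {L M} → L ≈ M → length L ≡ length M
  ≈-length []             = refl
  ≈-length (prep e p)     = cong suc (≈-length p)
  ≈-length (flip c x y p) = cong suc (≈-length p)
  ≈-length (swap e f p)   = cong (suc ∘ suc) (≈-length p)
  ≈-length (≈-trans p q)  = trans (≈-length p) (≈-length q)

  W-≈ : ∀ g {L M} → L ≈ M → ∀ v → W g L v ≡ W g M v
  W-≈ g []                     v = refl
  W-≈ g (prep (c , x , y) p)   v = cong (_ +_) (W-≈ g p v)
  W-≈ g (flip c x y p)         v = cong₂ _+_ (+-comm (on x v _) _) (W-≈ g p v)
  W-≈ g (swap (c , x , y) (d , z , w) p) v rewrite W-≈ g p v =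
    x∙yz≈y∙xz (on x v (g c x y) + on y v (g c y x)) (on z v (g d z w) + on w v (g d w z)) _
  W-≈ g (≈-trans p q)          v = trans (W-≈ g p v) (W-≈ g q v)

  data Adj (c : Bool) : List Edge → A → A → Set where
    fwd  : ∀ {x y L} → Adj c ((c , x , y) ∷ L) x y
    bwd  : ∀ {x y L} → Adj c ((c , x , y) ∷ L) y x
    next : ∀ {e L x y} → Adj c L x y → Adj c (e ∷ L) x y

  Adj-sym : ∀ {c L x y} → Adj c L x y → Adj c L y x
  Adj-sym fwd      = bwd
  Adj-sym bwd      = fwd
  Adj-sym (next a) = next (Adj-sym a)

  Adj-≈ : ∀ {c L M x y} → L ≈ M → Adj c L x y → Adj c M x y
  Adj-≈ (prep e p)     fwd             = fwd
  Adj-≈ (prep e p)     bwd             = bwd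
  Adj-≈ (prep e p)     (next a)        = next (Adj-≈ p a)
  Adj-≈ (flip c x y p) fwd             = bwd
  Adj-≈ (flip c x y p) bwd             = fwd
  Adj-≈ (flip c x y p) (next a)        = next (Adj-≈ p a)
  Adj-≈ (swap e f p)   fwd             = next fwd
  Adj-≈ (swap e f p)   bwd             = next bwd
  Adj-≈ (swap e f p)   (next fwd)      = fwd
  Adj-≈ (swap e f p)   (next bwd)      = bwd
  Adj-≈ (swap e f p)   (next (next a)) = next (next (Adj-≈ p a))
  Adj-≈ (≈-trans p q)  a               = Adj-≈ q (Adj-≈ p a)

  Conn : Bool → List Edge → A → A → Set
  Conn c L = Star (Adj c L)

  Conn-sym : ∀ {c L x y} → Conn c L x y → Conn c L y x
  Conn-sym = reverse Adj-sym

  Conn-⊆ : ∀ {c L M} → (∀ {x y} → Adj c L x y → Conn c M x y) → ∀ {x y} → Conn c L x y → Conn c M x y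
  Conn-⊆ = kleisliStar id

  extract-Adj : ∀ {c L x y} → Adj c L x y → ∃ λ L₀ → L ≈ (c , x , y) ∷ L₀
  extract-Adj (fwd {L = L})      = L , ≈-refl
  extract-Adj (bwd {L = L})      = L , flip _ _ _ ≈-refl
  extract-Adj (next {e = e} a) with extract-Adj a
  ... | L₀ , p = e ∷ L₀ , ≈-trans (prep e p) (swap e _ ≈-refl)

  on-pos : ∀ x v {k} → 0 < on x v k → x ≡ v × 0 < k
  on-pos x v pos with x ≟ v
  ... | yes x≡v = x≡v , pos

  +-pos : ∀ a {b} → 0 < a + b → 0 < a ⊎ 0 < b
  +-pos zero    pos = inj₂ pos
  +-pos (suc a) pos = inj₁ (s≤s z≤n)

  -- A positive sum has a positive term. With a weight that marks certain neighbours this finds an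
  -- edge to one of them.
  extract-W : ∀ g L v → 0 < W g L v → ∃ λ c → ∃₂ λ y L₀ → L ≈ (c , v , y) ∷ L₀ × 0 < g c v y
  extract-W g ((c , x , y) ∷ L) v pos with +-pos (on x v (g c x y) + on y v (g c y x)) pos
  ... | inj₂ later with extract-W g L v later
  ...   | d , z , L₀ , p , gpos = d , z , _ , ≈-trans (prep _ p) (swap _ _ ≈-refl) , gpos
  extract-W g ((c , x , y) ∷ L) v pos | inj₁ now with +-pos (on x v (g c x y)) now
  ... | inj₁ l with on-pos x v l
  ...   | refl , gpos = c , y , L , ≈-refl , gpos
  extract-W g ((c , x , y) ∷ L) v pos | inj₁ now | inj₂ r with on-pos y v r
  ...   | refl , gpos = c , x , L , flip _ _ _ ≈-refl , gpos

  AllEnds : (A → Set) → List Edge → Set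
  AllEnds P = All (λ e → P (proj₁ (proj₂ e)) × P (proj₂ (proj₂ e)))

  Avoids : A → List Edge → Set
  Avoids v = AllEnds (_≢ v)

  deg≡0⇒Avoids : ∀ {v} L → degree L v ≡ 0 → Avoids v L
  deg≡0⇒Avoids []                eq = []
  deg≡0⇒Avoids {v} ((c , x , y) ∷ L) eq with x ≟ v | y ≟ v
  ... | no x≢v | no y≢v = (x≢v , y≢v) ∷ deg≡0⇒Avoids L eq

  Avoids⇒W≡0 : ∀ {g v L} → Avoids v L → W g L v ≡ 0
  Avoids⇒W≡0 [] = refl
  Avoids⇒W≡0 {g} (_∷_ {c , x , y} (x≢v , y≢v) av)
    rewrite on-≢ {k = g c x y} x≢v | on-≢ {k = g c y x} y≢v = Avoids⇒W≡0 av

  Avoids-Adj : ∀ {v c L x y} → Avoids v L → Adj c L x y → x ≢ v × y ≢ v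
  Avoids-Adj (n ∷ av)           fwd      = n
  Avoids-Adj ((x≢v , y≢v) ∷ av) bwd      = y≢v , x≢v
  Avoids-Adj (n ∷ av)           (next a) = Avoids-Adj av a

  star : A → List (Bool × A) → List Edge
  star v = map (λ s → proj₁ s , v , proj₂ s)

  Adj-star : ∀ {v c} S {L x y} → Adj c (star v S ++ L) x y →
             (∃ λ z → (c , z) ∈ S × (x ≡ v × y ≡ z ⊎ x ≡ z × y ≡ v)) ⊎ Adj c L x y
  Adj-star []      a        = inj₂ a
  Adj-star (s ∷ S) fwd      = inj₁ (_ , here refl , inj₁ (refl , refl))
  Adj-star (s ∷ S) bwd      = inj₁ (_ , here refl , inj₂ (refl , refl))
  Adj-star (s ∷ S) (next a) = Sum.map₁ (λ (z , z∈ , q) → z , there z∈ , q) (Adj-star S a)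

  -- Moving v onto x maps walks to walks.
  contract : ∀ {v c M} S {L} → Avoids v L → ∀ x →
             (∀ {z} → (c , z) ∈ S → z ≢ v × Conn c M x z) →
             (∀ {u w} → Adj c L u w → Conn c M u w) →
             ∀ {u w} → u ≢ v → w ≢ v → Conn c (star v S ++ L) u w → Conn c M u w
  contract {v} {c} {M} S {L} av x nb sub {u} {w} u≢v w≢v walk =
    subst₂ (Conn c M) (glue-≢ u≢v) (glue-≢ w≢v) (kleisliStar φ image walk)
    where
    φ : A → A
    φ = glue x v

    image : ∀ {u w} → Adj c (star v S ++ L) u w → Conn c M (φ u) (φ w)
    image a with Adj-star S a
    ... | inj₂ a′ with Avoids-Adj av a′
    ...   | u≢v , w≢v = subst₂ (Conn c M) (sym (glue-≢ u≢v)) (sym (glue-≢ w≢v)) (sub a′)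
    image a | inj₁ (z , z∈ , inj₁ (refl , refl)) with nb z∈
    ...   | z≢v , walk = subst₂ (Conn c M) (sym (glue-b x v)) (sym (glue-≢ z≢v)) walk
    image a | inj₁ (z , z∈ , inj₂ (refl , refl)) with nb z∈
    ...   | z≢v , walk = subst₂ (Conn c M) (sym (glue-≢ z≢v)) (sym (glue-b x v)) (Conn-sym walk)

  -- Spanning colourings, recolourings and solutions

  Spanning : List A → List Edge → Set
  Spanning V L = ∀ c {u w} → u ∈ V → w ∈ V → Conn c L u w

  exit : ∀ {c L v u} → Conn c L v u → u ≢ v → ∃ λ y → y ≢ v × Adj c L v y
  exit ε u≢v = contradiction refl u≢v
  exit {v = v} (_◅_ {j = y} a walk) u≢v with y ≟ v
  ... | yes refl = exit walk u≢v
  ... | no y≢v   = y , y≢v , a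

  -- Order and orientation are fixed, so that the new colours can later be read off edge by edge and
  -- colour-blind weights, degrees in particular, are unchanged.
  data Recol : List Edge → List Edge → Set where
    []  : Recol [] []
    _∷_ : ∀ {x y M L} c {d} → Recol M L → Recol ((c , x , y) ∷ M) ((d , x , y) ∷ L)

  Recol-W : ∀ {g : A → A → ℕ} {M L} → Recol M L → ∀ v → W (λ _ → g) M v ≡ W (λ _ → g) L v
  Recol-W []      v = refl
  Recol-W (c ∷ r) v = cong (_ +_) (Recol-W r v)

  -- The reductions recolour a rearranged list; undoing each rearrangement on the colours yields a
  -- recolouring of the original list.
  Recol-≈ : ∀ {L L′ M′} → L ≈ L′ → Recol M′ L′ → ∃ λ M → Recol M L × M ≈ M′
  Recol-≈ [] [] = [] , [] , []
  Recol-≈ (prep e p) (c ∷ r) with Recol-≈ p r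
  ... | M , r′ , q = _ , c ∷ r′ , prep _ q
  Recol-≈ (flip _ _ _ p) (c ∷ r) with Recol-≈ p r
  ... | M , r′ , q = _ , c ∷ r′ , flip _ _ _ q
  Recol-≈ (swap e f p) (c ∷ d ∷ r) with Recol-≈ p r
  ... | M , r′ , q = _ , d ∷ c ∷ r′ , swap _ _ q
  Recol-≈ (≈-trans p q) r with Recol-≈ q r
  ... | M , r′ , q′ with Recol-≈ p r′
  ...   | M″ , r″ , p′ = M″ , r″ , ≈-trans p′ q′

  Balanced : List A → List Edge → Set
  Balanced V L = ∀ c {v} → v ∈ V → cdeg c L v ≤ 6 + cdeg (not c) L v

  -- The field `size` is the upper bound 2(n - 1) without subtraction. Two spanning colours need as
  -- many edges, so it forces both to be trees; it also rules out an empty vertex list.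
  record Shape (V : List A) (L : List Edge) : Set where
    constructor shape
    field
      unique : Unique V
      within   : AllEnds (_∈ V) L
      size   : 2 + length L ≤ 2 * length V

  open Shape public

  Solution : List A → List Edge → Set
  Solution V L = ∃ λ M → Recol M L × Spanning V M × Balanced V M

  ends-≈ : ∀ {P : A → Set} {L M} → L ≈ M → AllEnds P L →
           AllEnds P M
  ends-≈ []              []              = []
  ends-≈ (prep e p)      (h ∷ hs)        = h ∷ ends-≈ p hs
  ends-≈ (flip _ _ _ p)  ((a , b) ∷ hs)  = (b , a) ∷ ends-≈ p hs
  ends-≈ (swap e f p)    (h ∷ k ∷ hs)    = k ∷ h ∷ ends-≈ p hs
  ends-≈ (≈-trans p q)   hs              = ends-≈ q (ends-≈ p hs)

  Unique-↭ : ∀ {V V′ : List A} → V ↭ V′ → Unique V → Unique V′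
  Unique-↭ p = Permₛ.Unique-resp-↭ (setoid A) (↭⇒↭ₛ p)

  Shape-resp : ∀ {V V′ L L′} → V ↭ V′ → L ≈ L′ → Shape V L → Shape V′ L′
  Shape-resp p q (shape u e s) = shape (Unique-↭ p u)
    (All.map (λ (a , b) → ∈-resp-↭ p a , ∈-resp-↭ p b) (ends-≈ q e))
    (subst₂ (λ l k → 2 + l ≤ 2 * k) (≈-length q) (↭-length p) s)

  Connected-resp : ∀ {V V′ L L′} → V ↭ V′ → L ≈ L′ → Spanning V L → Spanning V′ L′
  Connected-resp p q con c u∈ w∈ =
    Conn-⊆ (return ∘ Adj-≈ q) (con c (∈-resp-↭ (↭-sym p) u∈) (∈-resp-↭ (↭-sym p) w∈))

  Solution-resp : ∀ {V V′ L L′} → V ↭ V′ → L ≈ L′ → Solution V′ L′ → Solution V L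
  Solution-resp p q (M′ , r′ , con , bal) with Recol-≈ q r′
  ... | M , r , M≈M′ = M , r , Connected-resp (↭-sym p) (≈-sym M≈M′) con ,
    λ c {v} v∈ → subst₂ (λ a b → a ≤ 6 + b)
      (W-≈ _ (≈-sym M≈M′) v) (W-≈ _ (≈-sym M≈M′) v) (bal c (∈-resp-↭ p v∈))

  W-star : ∀ g {v} S {L} → All (λ s → proj₂ s ≢ v) S → Avoids v L →
           W g (star v S ++ L) v ≡ sum (map (λ s → g (proj₁ s) v (proj₂ s)) S)
  W-star g []            []         av = Avoids⇒W≡0 av
  W-star g {v} ((c , z) ∷ S) (z≢v ∷ ne) av
    rewrite on-refl v {g c v z} | on-≢ {k = g c z v} z≢v | +-identityʳ (g c v z) =
    cong (g c v z +_) (W-star g S ne av)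

  cdeg-pos : ∀ {V L v u} → Spanning V L → v ∈ V → u ∈ V → u ≢ v → ∀ c → 1 ≤ cdeg c L v
  cdeg-pos {L = L} {v} con v∈ u∈ u≢v c with exit (con c v∈ u∈) u≢v
  ... | y , _ , a with extract-Adj a
  ...   | L₀ , p = begin
    1                                           ≡⟨ col-refl c ⟨
    col c c                                     ≡⟨ on-refl v ⟨
    on v v (col c c)                            ≤⟨ m≤m+n _ _ ⟩
    on v v (col c c) + on y v (col c c)         ≤⟨ m≤m+n _ _ ⟩
    cdeg c ((c , v , y) ∷ L₀) v                 ≡⟨ W-≈ _ p v ⟨
    cdeg c L v                                  ∎
    where open ≤-Reasoning

  -- Each colour has a half-edge at `v`, so the other has at most 7 of the 8, and 7 <= 6 + 1.
  low-balanced : ∀ {V L v u} → Spanning V L → v ∈ V → u ∈ V → u ≢ v → degree L v ≤ 8 →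
                 ∀ c → cdeg c L v ≤ 6 + cdeg (not c) L v
  low-balanced {L = L} {v} con v∈ u∈ u≢v d≤8 c = +-cancelʳ-≤ (cdeg (not c) L v) _ _ (begin
    cdeg c L v + cdeg (not c) L v               ≡⟨ split c ⟩
    degree L v                                     ≤⟨ d≤8 ⟩
    6 + (1 + 1)                                 ≤⟨ +-monoʳ-≤ 6 (+-mono-≤ pos pos) ⟩
    6 + (cdeg (not c) L v + cdeg (not c) L v)   ≡⟨ +-assoc 6 (cdeg (not c) L v) _ ⟨
    6 + cdeg (not c) L v + cdeg (not c) L v     ∎)
    where
    open ≤-Reasoning
    pos : 1 ≤ cdeg (not c) L v
    pos = cdeg-pos con v∈ u∈ u≢v (not c)
    split : ∀ c → cdeg c L v + cdeg (not c) L v ≡ degree L v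
    split true  = sym (deg-split L v)
    split false = trans (+-comm (cdeg false L v) _) (sym (deg-split L v))

  tail≢ : ∀ {v u} {V : List A} → Unique (v ∷ V) → u ∈ V → u ≢ v
  tail≢ (ne ∷ _) u∈ refl = All.lookup ne u∈ refl

  untail : ∀ {v u} {V : List A} → u ∈ v ∷ V → u ≢ v → u ∈ V
  untail (here eq)  u≢v = contradiction eq u≢v
  untail (there u∈) u≢v = u∈

  drop-ends : ∀ {v V L} → Avoids v L →
              AllEnds (_∈ v ∷ V) L →
              AllEnds (_∈ V) L
  drop-ends []                   []               = []
  drop-ends ((x≢v , y≢v) ∷ av)   ((x∈ , y∈) ∷ es) = (untail x∈ x≢v , untail y∈ y≢v) ∷ drop-ends av es

  drop-size : ∀ l k → 2 + (2 + l) ≤ 2 * suc k → 2 + l ≤ 2 * k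
  drop-size l k le = +-cancelˡ-≤ 2 _ _ (subst (2 + (2 + l) ≤_) (*-suc 2 k) le)

  attach : ∀ {v V L} → Spanning V L → (∀ c → ∃ λ y → y ∈ V × Conn c L v y) → Spanning (v ∷ V) L
  attach con at c (here refl) (here refl) = ε
  attach con at c (here refl) (there w∈)  = let y , y∈ , walk = at c in walk ◅◅ con c y∈ w∈
  attach con at c (there u∈)  (here refl) = let y , y∈ , walk = at c in con c u∈ y∈ ◅◅ Conn-sym walk
  attach con at c (there u∈)  (there w∈)  = con c u∈ w∈

  add₂ : ∀ {v p q V L} s → p ∈ V → q ∈ V → Spanning V L →
         Spanning (v ∷ V) ((s , v , p) ∷ (not s , v , q) ∷ L)
  add₂ s p∈ q∈ con = attach (λ c u∈ w∈ → Conn-⊆ (return ∘ next ∘ next) (con c u∈ w∈)) at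
    where
    at : ∀ c → _
    at c with s Boolₚ.≟ c
    ... | yes refl = _ , p∈ , return fwd
    ... | no  s≢c  = _ , q∈ , return (next (subst (λ d → Adj c ((d , _ , _) ∷ _) _ _) (≢⇒≡not s≢c) fwd))

  -- In each colour `v` is a leaf, so walks survive when `v` is moved onto its only neighbour of
  -- that colour.
  delete₂ : ∀ {v p q V L} s → Unique (v ∷ V) → p ≢ v → q ≢ v → Avoids v L →
            Spanning (v ∷ V) ((s , v , p) ∷ (not s , v , q) ∷ L) → Spanning V L
  delete₂ {v} {p} {q} {V} {L} s un p≢v q≢v av con c {u} {w} u∈ w∈ with s Boolₚ.≟ c
  ... | yes refl = contract ((s , p) ∷ (not s , q) ∷ []) av p nb return
                     (tail≢ un u∈) (tail≢ un w∈) (con s (there u∈) (there w∈))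
    where
    nb : ∀ {z} → (s , z) ∈ (s , p) ∷ (not s , q) ∷ [] → z ≢ v × Conn s L p z
    nb (here refl)       = p≢v , ε
    nb (there (here eq)) = contradiction (sym (cong proj₁ eq)) (not≢ s)
  ... | no s≢c with ≢⇒≡not s≢c
  ...   | refl = contract ((s , p) ∷ (not s , q) ∷ []) av q nb return
                     (tail≢ un u∈) (tail≢ un w∈) (con (not s) (there u∈) (there w∈))
    where
    nb : ∀ {z} → (not s , z) ∈ (s , p) ∷ (not s , q) ∷ [] → z ≢ v × Conn (not s) L q z
    nb (here eq)           = contradiction (cong proj₁ eq) (not≢ s)
    nb (there (here refl)) = q≢v , ε

  -- A walk of colour `not s` has to leave `v`, and only the second edge can carry it.
  opposite : ∀ {v p q s t V L} → p ≢ v → p ∈ V → Avoids v L →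
             Spanning (v ∷ V) ((s , v , p) ∷ (t , v , q) ∷ L) → t ≡ not s
  opposite {v} {p} {q} {s} {t} p≢v p∈ av con with exit (con (not s) (here refl) (there p∈)) p≢v
  ... | y , _ , a with Adj-star ((s , p) ∷ (t , q) ∷ []) a
  ...   | inj₁ (z , here eq , _)         = contradiction (cong proj₁ eq) (not≢ s)
  ...   | inj₁ (z , there (here eq) , _) = sym (cong proj₁ eq)
  ...   | inj₂ a′                        = contradiction refl (proj₁ (Avoids-Adj av a′))

  -- Reductions to a graph with fewer vertices

  Solvable : List A → Set
  Solvable V = ∀ L → Shape V L → Spanning V L → Solution V L

  deficient : ∀ L v → ∃ λ s → cdeg s L v ≤ cdeg (not s) L v
  deficient L v = [ true ,_ , false ,_ ]′ (≤-total (cdeg true L v) (cdeg false L v))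

  -- The new edge takes the colour in the minority: the difference in favour of `not d` shrinks, and
  -- the one in favour of `d` is at most 1 afterwards.
  nudge : ∀ d M v → cdeg d M v ≤ cdeg (not d) M v → (∀ c → cdeg c M v ≤ 6 + cdeg (not c) M v) →
          ∀ c → col c d + cdeg c M v ≤ 6 + (col (not c) d + cdeg (not c) M v)
  nudge true  M v le bal true  = s≤s (≤-trans le (m≤n+m _ 5))
  nudge true  M v le bal false = ≤-trans (bal false) (+-monoʳ-≤ 6 (n≤1+n _))
  nudge false M v le bal true  = ≤-trans (bal true) (+-monoʳ-≤ 6 (n≤1+n _))
  nudge false M v le bal false = s≤s (≤-trans le (m≤n+m _ 5))

  -- the contribution of edges vp and vq, coloured s and not s, at a vertex u ≢ v
  ext : A → A → Bool → Bool → A → ℕ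
  ext p q s c u = on p u (col c s) + on q u (col c (not s))

  balanced₂ : ∀ {v p q V M} s → p ∈ V → q ∈ V → p ≢ v → q ≢ v → Avoids v M → Spanning V M →
    (∀ {u} → u ∈ V → degree ((s , v , p) ∷ (not s , v , q) ∷ M) u ≤ 8 ⊎
      (∀ c → ext p q s c u + cdeg c M u ≤ 6 + (ext p q s (not c) u + cdeg (not c) M u))) →
    Balanced (v ∷ V) ((s , v , p) ∷ (not s , v , q) ∷ M)
  balanced₂ {v} {p} {q} {V} {M} s p∈ q∈ p≢v q≢v av conM h c {u} u∈ = bal
    where
    N = (s , v , p) ∷ (not s , v , q) ∷ M
    conN : Spanning (v ∷ V) N
    conN = add₂ s p∈ q∈ conM
    reassoc : ∀ a b m → a + (b + m) ≡ a + b + m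
    reassoc = solve-∀
    cdeg-N : u ≢ v → ∀ c → ext p q s c u + cdeg c M u ≡ cdeg c N u
    cdeg-N u≢v c rewrite on-≢ {k = col c s} (≢-sym u≢v) | on-≢ {k = col c (not s)} (≢-sym u≢v) =
      sym (reassoc (on p u (col c s)) (on q u (col c (not s))) _)
    bal : cdeg c N u ≤ 6 + cdeg (not c) N u
    bal with u ≟ v
    ... | yes refl = low-balanced conN (here refl) (there p∈) p≢v
                       (subst (_≤ 8) (sym (W-star one ((s , p) ∷ (not s , q) ∷ []) (p≢v ∷ q≢v ∷ []) av)) (s≤s (s≤s z≤n))) c
    ... | no u≢v with h (untail u∈ u≢v)
    ...   | inj₁ low = low-balanced conN u∈ (here refl) (≢-sym u≢v) low c
    ...   | inj₂ le  = subst₂ (λ a b → a ≤ 6 + b) (cdeg-N u≢v c) (cdeg-N u≢v (not c)) (le c)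

  Avoids-Recol : ∀ {v M L} → Recol M L → Avoids v L → Avoids v M
  Avoids-Recol []      []       = []
  Avoids-Recol (c ∷ r) (n ∷ av) = n ∷ Avoids-Recol r av

  -- Delete the vertex v of degree 2. Its two edges may be coloured either way,
  -- so a single neighbour of high degree can be favoured.
  reduce₁ : ∀ {v p q V L} → let L₊ = (true , v , p) ∷ (false , v , q) ∷ L in
            Shape (v ∷ V) L₊ → Spanning (v ∷ V) L₊ → Avoids v L → p ≢ v → q ≢ v →
            p ≡ q ⊎ degree L₊ q ≤ 8 ⊎ degree L₊ p ≤ 8 → Solvable V → Solution (v ∷ V) L₊
  reduce₁ {v} {p} {q} {V} {L} (shape un ((_ , p∈) ∷ (_ , q∈) ∷ es) sz) con av p≢v q≢v low ih
    with ih L (shape (AllPairs.tail un) (drop-ends av es) (drop-size (length L) (length V) sz)) (delete₂ true un p≢v q≢v av con)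
  ... | M , r , conM , balM = finish low
    where
    p∈V = untail p∈ p≢v
    q∈V = untail q∈ q≢v
    L₊ = (true , v , p) ∷ (false , v , q) ∷ L

    Fine : Bool → A → Set
    Fine s u = degree L₊ u ≤ 8 ⊎
      (∀ c → ext p q s c u + cdeg c M u ≤ 6 + (ext p q s (not c) u + cdeg (not c) M u))

    fine-by : ∀ {s u} (k : Bool → ℕ) → (∀ c → k c ≡ ext p q s c u) →
              (∀ c → k c + cdeg c M u ≤ 6 + (k (not c) + cdeg (not c) M u)) → Fine s u
    fine-by {s} {u} k eq le = inj₂ λ c →
      subst₂ (λ a b → a + cdeg c M u ≤ 6 + (b + cdeg (not c) M u)) (eq c) (eq (not c)) (le c)

    off : ∀ {s u} → u ∈ V → u ≢ p → u ≢ q → Fine s u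
    off {s} u∈ u≢p u≢q = fine-by (λ _ → 0)
      (λ c → sym (cong₂ _+_ (on-≢ {k = col c s} (≢-sym u≢p)) (on-≢ {k = col c (not s)} (≢-sym u≢q)))) (λ c → balM c u∈)

    solve : ∀ s → (∀ {u} → u ∈ V → Fine s u) → Solution (v ∷ V) L₊
    solve s h = _ , s ∷ not s ∷ r , add₂ s p∈V q∈V conM ,
      balanced₂ s p∈V q∈V p≢v q≢v (Avoids-Recol r av) conM
        λ {u} u∈ → Sum.map₁ (subst (_≤ 8) (sym (Recol-W {λ _ _ → 1} {L = L₊} (s ∷ not s ∷ r) u))) (h u∈)

    finish : p ≡ q ⊎ degree L₊ q ≤ 8 ⊎ degree L₊ p ≤ 8 → Solution (v ∷ V) L₊
    -- The double neighbour receives one edge of each colour, so either choice leaves its difference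
    -- alone.
    finish (inj₁ refl) = solve true λ {u} u∈ → fine-by (λ _ → on p u 1) (both u) λ c →
      ≤-trans (+-monoʳ-≤ (on p u 1) (balM c u∈)) (≤-reflexive (x∙yz≈y∙xz (on p u 1) 6 _))
      where
      both : ∀ u c → on p u 1 ≡ on p u (col c true) + on p u (col c false)
      both u true  = on-+ p u 1 0
      both u false = on-+ p u 0 1
    finish (inj₂ (inj₁ q-low)) with deficient M p
    ... | s , le = solve s fine
      where
      fine : ∀ {u} → u ∈ V → Fine s u
      fine {u} u∈ with u ≟ q | u ≟ p
      ... | yes refl | _ = inj₁ q-low
      ... | no u≢q | yes refl = fine-by (λ c → col c s)
        (λ c → sym (trans (cong₂ _+_ (on-refl p {col c s}) (on-≢ {k = col c (not s)} (≢-sym u≢q))) (+-identityʳ _)))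
        (nudge s M p le (λ c → balM c u∈))
      ... | no u≢q | no u≢p = off u∈ u≢p u≢q
    -- Here `q` is favoured: `vq` must get the minority colour `s`, and `vp` has the opposite one.
    finish (inj₂ (inj₂ p-low)) with deficient M q
    ... | s , le = solve (not s) fine
      where
      fine : ∀ {u} → u ∈ V → Fine (not s) u
      fine {u} u∈ with u ≟ p | u ≟ q
      ... | yes refl | _ = inj₁ p-low
      ... | no u≢p | yes refl = fine-by (λ c → col c s)
        (λ c → sym (trans (cong₂ _+_ (on-≢ {k = col c (not s)} (≢-sym u≢p)) (on-refl q {col c (not (not s))}))
                   (cong (col c) (Boolₚ.not-involutive s))))
        (nudge s M q le (λ c → balM c u∈))
      ... | no u≢p | no u≢q = off u∈ u≢p u≢q

  swap₂ : ∀ e f g h {L} → e ∷ f ∷ g ∷ h ∷ L ≈ g ∷ h ∷ e ∷ f ∷ L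
  swap₂ e f g h = ≈-trans (prep e (swap f g ≈-refl)) (≈-trans (swap e g ≈-refl)
    (prep g (≈-trans (prep e (swap f h ≈-refl)) (swap e h ≈-refl))))

  -- Splice the paths p-w-u and u-x-q into p-w-q. In every colouring of the
  -- result wp and wq differ, so u can receive one edge of each colour.
  reduce₂ : ∀ {w x p u q a b V L} →
            let L₊ = (a , w , p) ∷ (not a , w , u) ∷ (b , x , u) ∷ (not b , x , q) ∷ L in
            Shape (x ∷ w ∷ V) L₊ → Spanning (x ∷ w ∷ V) L₊ → Avoids w L → Avoids x L →
            p ≢ w → p ≢ x → u ≢ w → u ≢ x → q ≢ w → q ≢ x →
            Solvable (w ∷ V) → Solution (x ∷ w ∷ V) L₊
  reduce₂ {w} {x} {p} {u} {q} {a} {b} {V} {L}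
          (shape un@((x≢w ∷ ne) ∷ un₀) ((w∈ , p∈) ∷ (_ , u∈) ∷ _ ∷ (_ , q∈) ∷ es) sz)
          con avw avx p≢w p≢x u≢w u≢x q≢w q≢x ih = result
    where
    w≢x = ≢-sym x≢w
    p∈V = untail (untail p∈ p≢x) p≢w
    u∈V = untail (untail u∈ u≢x) u≢w
    q∈V = untail (untail q∈ q≢x) q≢w
    conV : Spanning V L
    conV = delete₂ b (ne ∷ AllPairs.tail un₀) u≢x q≢x avx
      (delete₂ a ((w≢x ∷ AllPairs.head un₀) ∷ (ne ∷ AllPairs.tail un₀)) p≢w u≢w
        ((x≢w , u≢w) ∷ (x≢w , q≢w) ∷ avw)
        (Connected-resp (swap x w ↭-refl) ≈-refl con))
    -- `x` disappears and `w` takes over its end `q`, so one vertex and two edges are lost.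
    L₁ = (a , w , p) ∷ (not a , w , q) ∷ L
    shape₁ : Shape (w ∷ V) L₁
    shape₁ = shape un₀ ((here refl , there p∈V) ∷ (here refl , there q∈V) ∷ drop-ends avx es)
                   (drop-size (length L₁) (suc (length V)) sz)

    result : Solution (x ∷ w ∷ V) _
    result with ih L₁ shape₁ (add₂ a p∈V q∈V conV)
    ... | (s , _ , _) ∷ (t , _ , _) ∷ M , (s ∷ t ∷ r) , conM , balM
      with opposite p≢w p∈V (Avoids-Recol r avw) conM
    ...   | refl = N , s ∷ not s ∷ s ∷ not s ∷ r , conN , bal
      where
      avw′ : Avoids w M
      avw′ = Avoids-Recol r avw
      avx′ : Avoids x M
      avx′ = Avoids-Recol r avx
      -- `p` and `q` see the colours they saw in the smaller graph; `u` gains one of each.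
      N = (s , w , p) ∷ (not s , w , u) ∷ (s , x , u) ∷ (not s , x , q) ∷ M
      conN : Spanning (x ∷ w ∷ V) N
      conN = Connected-resp (swap w x ↭-refl) ≈-refl (add₂ s (there p∈V) (there u∈V)
        (add₂ s u∈V q∈V (delete₂ s un₀ p≢w q≢w avw′ conM)))
      slide : ∀ a b c d m → c + b + (a + (d + m)) ≡ a + (b + (c + (d + m)))
      slide = solve-∀
      both : ∀ c y → on u y (col c s) + on u y (col c (not s)) ≡ on u y 1
      both c y = trans (sym (on-+ u y (col c s) (col c (not s)))) (cong (on u y) (col-not c s))
        where
        col-not : ∀ c s → col c s + col c (not s) ≡ 1
        col-not true  true  = refl
        col-not true  false = refl
        col-not false true  = refl
        col-not false false = refl
      cdeg-N : ∀ {y} → y ≢ w → y ≢ x → ∀ c → on u y 1 + cdeg c ((s , w , p) ∷ (not s , w , q) ∷ M) y ≡ cdeg c N y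
      cdeg-N {y} y≢w y≢x c
        rewrite on-≢ {k = col c s} (≢-sym y≢w) | on-≢ {k = col c (not s)} (≢-sym y≢w)
              | on-≢ {k = col c s} (≢-sym y≢x) | on-≢ {k = col c (not s)} (≢-sym y≢x)
              | sym (both c y) =
        slide (on p y (col c s)) (on u y (col c (not s))) (on u y (col c s)) (on q y (col c (not s))) (cdeg c M y)
      bal : Balanced (x ∷ w ∷ V) N
      bal c {y} y∈ with y ≟ w
      ... | yes refl = low-balanced conN y∈ (here refl) x≢w
        (subst (_≤ 8) (sym (W-star one {w} ((s , p) ∷ (not s , u) ∷ []) {(s , x , u) ∷ (not s , x , q) ∷ M} (p≢w ∷ u≢w ∷ [])
          ((x≢w , u≢w) ∷ (x≢w , q≢w) ∷ avw′))) (s≤s (s≤s z≤n))) c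
      ... | no y≢w with y ≟ x
      ...   | yes refl = low-balanced conN y∈ (there (here refl)) w≢x
        (subst (_≤ 8) (sym (trans (W-≈ one (swap₂ (s , w , p) (not s , w , u) (s , x , u) (not s , x , q) {M}) x) (W-star one {x} ((s , u) ∷ (not s , q) ∷ []) {(s , w , p) ∷ (not s , w , u) ∷ M} (u≢x ∷ q≢x ∷ [])
          ((w≢x , p≢x) ∷ (w≢x , u≢x) ∷ avx′)))) (s≤s (s≤s z≤n))) c
      ...   | no y≢x = subst₂ (λ m n → m ≤ 6 + n) (cdeg-N y≢w y≢x c) (cdeg-N y≢w y≢x (not c))
        (≤-trans (+-monoʳ-≤ (on u y 1) (balM c (untail y∈ y≢x))) (≤-reflexive (x∙yz≈y∙xz (on u y 1) 6 _)))

  -- Replace the path p-v-q by an edge; only the degrees of r are disturbed.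
  reduce₃ : ∀ {v p q r a b d c V L} →
            let L₊ = (a , v , p) ∷ (b , v , q) ∷ (d , v , r) ∷ L in
            Shape (v ∷ V) L₊ → Avoids v L → p ≢ v → q ≢ v → r ≢ v →
            Spanning V ((c , p , q) ∷ L) → degree L₊ r ≤ 8 → Solvable V → Solution (v ∷ V) L₊
  reduce₃ {v} {p} {q} {r} {a} {b} {d} {c₀} {V} {L}
          (shape un ((_ , p∈) ∷ (_ , q∈) ∷ (_ , r∈) ∷ es) sz) av p≢v q≢v r≢v con low ih = result
    where
    p∈V = untail p∈ p≢v
    q∈V = untail q∈ q≢v
    r∈V = untail r∈ r≢v
    L₊ = (a , v , p) ∷ (b , v , q) ∷ (d , v , r) ∷ L

    result : Solution (v ∷ V) L₊
    result with ih ((c₀ , p , q) ∷ L)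
                   (shape (AllPairs.tail un) ((p∈V , q∈V) ∷ drop-ends av es)
                     (drop-size (suc (length L)) (length V) sz)) con
    ... | (s , _ , _) ∷ M , (s ∷ rec) , conM , balM = N , recN , conN , bal
      where
      -- The spliced edge may come back in any colour `s`. Subdividing it puts `v` into that tree,
      -- and `vr` in the other colour hangs `v` as a leaf on the other tree.
      N = (s , v , p) ∷ (s , v , q) ∷ (not s , v , r) ∷ M
      recN : Recol N L₊
      recN = s ∷ s ∷ not s ∷ rec
      av′ : Avoids v M
      av′ = Avoids-Recol rec av
      unfold : ∀ {c y z} → Adj c ((s , p , q) ∷ M) y z → Conn c N y z
      unfold fwd      = bwd ◅ next fwd ◅ ε
      unfold bwd      = next bwd ◅ fwd ◅ ε
      unfold (next e) = return (next (next (next e)))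
      at : ∀ c → ∃ λ y → y ∈ V × Conn c N v y
      at c with s Boolₚ.≟ c
      ... | yes refl = p , p∈V , return fwd
      ... | no s≢c with ≢⇒≡not s≢c
      ...   | refl = r , r∈V , return (next (next fwd))
      conN : Spanning (v ∷ V) N
      conN = attach (λ c y∈ z∈ → Conn-⊆ unfold (conM c y∈ z∈)) at
      reassoc : ∀ a b m → a + b + m ≡ a + (b + m)
      reassoc = solve-∀
      cdeg-N : ∀ {y} → y ≢ v → y ≢ r → ∀ c → cdeg c ((s , p , q) ∷ M) y ≡ cdeg c N y
      cdeg-N {y} y≢v y≢r c
        rewrite on-≢ {k = col c s} (≢-sym y≢v) | on-≢ {k = col c (not s)} (≢-sym y≢v)
              | on-≢ {k = col c (not s)} (≢-sym y≢r) =
        reassoc (on p y (col c s)) (on q y (col c s)) (cdeg c M y)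
      bal : Balanced (v ∷ V) N
      bal c {y} y∈ with y ≟ v
      ... | yes refl = low-balanced conN y∈ (there p∈V) p≢v
        (subst (_≤ 8) (sym (W-star one ((s , p) ∷ (s , q) ∷ (not s , r) ∷ []) (p≢v ∷ q≢v ∷ r≢v ∷ []) av′))
          (s≤s (s≤s (s≤s z≤n)))) c
      ... | no y≢v with y ≟ r
      ...   | yes refl = low-balanced conN y∈ (here refl) (≢-sym r≢v)
        (subst (_≤ 8) (sym (Recol-W {λ _ _ → 1} recN r)) low) c
      ...   | no y≢r = subst₂ (λ m n → m ≤ 6 + n) (cdeg-N y≢v y≢r c) (cdeg-N y≢v y≢r (not c))
                         (balM c (untail y∈ y≢v))

-- Discharging

module Discharge {A : Set} (_≟_ : DecidableEquality A) where
  open TwoTrees _≟_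
  open Points _≟_

  ∈⇒↭ : ∀ {v} {V : List A} → v ∈ V → ∃ λ V₀ → V ↭ v ∷ V₀
  ∈⇒↭ {v} v∈ with ∈-∃++ v∈
  ... | xs , ys , refl = xs ++ ys , shift v xs ys

  deg-cons : ∀ {v z} c L → z ≢ v → degree ((c , v , z) ∷ L) v ≡ suc (degree L v)
  deg-cons {v} {z} c L z≢v rewrite on-refl v {1} | on-≢ {k = 1} z≢v = refl

  deg-skip : ∀ {v y z} c L → y ≢ v → z ≢ v → degree ((c , y , z) ∷ L) v ≡ degree L v
  deg-skip c L y≢v z≢v rewrite on-≢ {k = 1} y≢v | on-≢ {k = 1} z≢v = refl

  deg-loop : ∀ {v} c L → degree ((c , v , v) ∷ L) v ≡ 2 + degree L v
  deg-loop {v} c L rewrite on-refl v {1} = refl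

  extract-last : ∀ L v → degree L v ≡ 1 → ∃ λ c → ∃₂ λ y L₀ → L ≈ (c , v , y) ∷ L₀ × y ≢ v × Avoids v L₀
  extract-last L v d≡1 with extract-W one L v (≤-reflexive (sym d≡1))
  ... | c , y , L₀ , p , _ with y ≟ v
  ...   | yes refl = contradiction (trans (sym (trans (W-≈ one p v) (deg-loop c L₀))) d≡1) λ ()
  ...   | no y≢v   = c , y , L₀ , p , y≢v ,
    deg≡0⇒Avoids L₀ (suc-injective (trans (sym (trans (W-≈ one p v) (deg-cons c L₀ y≢v))) d≡1))

  normal-form : ∀ {V L v u} → Spanning V L → v ∈ V → u ∈ V → u ≢ v →
                ∃ λ p → ∃₂ λ q L₀ → p ≢ v × q ≢ v × L ≈ (true , v , p) ∷ (false , v , q) ∷ L₀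
  normal-form con v∈ u∈ u≢v with exit (con true v∈ u∈) u≢v
  ... | p , p≢v , a with extract-Adj a
  ...   | L₁ , e₁ with exit (con false v∈ u∈) u≢v
  ...     | q , q≢v , b with Adj-≈ e₁ b
  ...       | next b′ with extract-Adj b′
  ...         | L₀ , e₂ = p , q , L₀ , p≢v , q≢v , ≈-trans e₁ (prep _ e₂)

  -- Degree 2 lacks 4 and will have two heavy neighbours, degree 3 lacks 2 and will have at least
  -- two: a heavy neighbour pays half of what is lacking.
  pay : ℕ → ℕ
  pay 2 = 2
  pay 3 = 1
  pay _ = 0

  is2 : ℕ → ℕ
  is2 2 = 1
  is2 _ = 0

  pay≤ : ∀ d → pay d ≤ 1 + is2 d
  pay≤ 0 = z≤n
  pay≤ 1 = z≤n
  pay≤ 2 = ≤-refl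
  pay≤ 3 = ≤-refl
  pay≤ (suc (suc (suc (suc _)))) = z≤n

  is2-pos : ∀ d → 0 < is2 d → d ≡ 2
  is2-pos 2 _ = refl

  toll : ℕ → ℕ → ℕ
  toll d e with 9 ≤? d
  ... | yes _ = pay e
  ... | no  _ = 0

  toll-high : ∀ {d} e → 9 ≤ d → toll d e ≡ pay e
  toll-high {d} e h with 9 ≤? d
  ... | yes _ = refl
  ... | no n  = contradiction h n

  toll-low : ∀ {d} e → d ≤ 8 → toll d e ≡ 0
  toll-low {d} e l with 9 ≤? d
  ... | yes h = contradiction (≤-trans h l) 1+n≰n
  ... | no n  = refl

  toll≤ : ∀ d e → toll d e ≤ 1 + is2 e
  toll≤ d e with 9 ≤? d
  ... | yes _ = pay≤ e
  ... | no  _ = z≤n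

  -- Every vertex v starts with charge 2 deg v - 8; a vertex of degree at least 9
  -- pays 2 to each neighbour of degree 2 and 1 to each neighbour of degree 3.
  outgoing incoming : List Edge → Weight
  outgoing L _ u v = toll (degree L u) (degree L v)
  incoming L _ u v = toll (degree L v) (degree L u)

  -- The charge left after all payments is not negative, with the subtracted terms moved to the
  -- left.
  Fair : List Edge → A → Set
  Fair L v = 8 + W (outgoing L) L v ≤ 2 * degree L v + W (incoming L) L v

  -- Local analysis: a vertex is fair or allows a reduction

  module Step (V : List A) (L : List Edge) (sh : Shape V L) (con : Spanning V L)
              (ih : ∀ V′ → length V′ < length V → Solvable V′) where

    D : A → ℕ
    D = degree L

    ih₁ : ∀ {v V₀} → V ↭ v ∷ V₀ → Solvable V₀
    ih₁ p = ih _ (≤-reflexive (sym (↭-length p)))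

    -- Only distinct heavy neighbours are beyond `reduce₁`. It expects the edge of colour `true`
    -- first, hence the two cases of `reduce`.
    two-vertex : ∀ {x c p d q L₀ V₀} → V ↭ x ∷ V₀ → L ≈ (c , x , p) ∷ (d , x , q) ∷ L₀ →
                 Avoids x L₀ → p ≢ x → q ≢ x →
                 Solution V L ⊎ (d ≡ not c × p ≢ q × 9 ≤ D p × 9 ≤ D q)
    two-vertex {x} {c} {p} {d} {q} {L₀} {V₀} V↭ L≈ av p≢x q≢x
      with opposite p≢x p∈ av con₊
      where
      sh₊  = Shape-resp V↭ L≈ sh
      con₊ = Connected-resp V↭ L≈ con
      p∈ : p ∈ V₀
      p∈ = untail (proj₂ (All.head (within sh₊))) p≢x
    ... | refl = decide (p ≟ q) (D p ≤? 8) (D q ≤? 8)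
      where
      reduce : ∀ c → L ≈ (c , x , p) ∷ (not c , x , q) ∷ L₀ → p ≡ q ⊎ D q ≤ 8 ⊎ D p ≤ 8 → Solution V L
      reduce true  e h = Solution-resp V↭ e (reduce₁ (Shape-resp V↭ e sh) (Connected-resp V↭ e con) av p≢x q≢x
        (Sum.map₂ (Sum.map (subst (_≤ 8) (W-≈ one e q)) (subst (_≤ 8) (W-≈ one e p))) h) (ih₁ V↭))
      reduce false e h = Solution-resp V↭ e′ (reduce₁ (Shape-resp V↭ e′ sh) (Connected-resp V↭ e′ con) av q≢x p≢x
        (Sum.map sym (Sum.swap ∘ Sum.map (subst (_≤ 8) (W-≈ one e′ q)) (subst (_≤ 8) (W-≈ one e′ p))) h) (ih₁ V↭))
        where e′ = ≈-trans e (swap _ _ ≈-refl)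
      decide : Dec (p ≡ q) → Dec (D p ≤ 8) → Dec (D q ≤ 8) → Solution V L ⊎ (not c ≡ not c × p ≢ q × 9 ≤ D p × 9 ≤ D q)
      decide (yes p≡q) _ _ = inj₁ (reduce c L≈ (inj₁ p≡q))
      decide (no _) (yes l) _ = inj₁ (reduce c L≈ (inj₂ (inj₂ l)))
      decide (no _) (no _) (yes l) = inj₁ (reduce c L≈ (inj₂ (inj₁ l)))
      decide (no p≢q) (no hp) (no hq) = inj₂ (refl , p≢q , ≰⇒> hp , ≰⇒> hq)

    -- In colour `c` the vertex `v` is moved onto `a`, from which `M` reaches both `x` and `y`; in
    -- the other colour `v` is a leaf and is moved onto `z`. In its uses `M` is the rest of the
    -- graph with the edge that replaces a path through `v`.
    merge-connected : ∀ {v c x y z a L₀ V₀ M} → V ↭ v ∷ V₀ →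
      L ≈ (c , v , x) ∷ (c , v , y) ∷ (not c , v , z) ∷ L₀ → Avoids v L₀ →
      x ≢ v → y ≢ v → z ≢ v →
      (∀ {d u w} → Adj d L₀ u w → Conn d M u w) → Conn c M a x → Conn c M a y →
      Spanning V₀ M
    merge-connected {v} {c} {x} {y} {z} {a} {L₀} {V₀} {M} V↭ L≈ av x≢v y≢v z≢v sub a~x a~y d {u} {w} u∈ w∈ = go
      where
      S = (c , x) ∷ (c , y) ∷ (not c , z) ∷ []
      un = Unique-↭ V↭ (unique sh)
      walk : Conn d (star v S ++ L₀) u w
      walk = Connected-resp V↭ L≈ con d (there u∈) (there w∈)
      go : Conn d M u w
      go with c Boolₚ.≟ d
      ... | yes refl = contract S av a nb sub (tail≢ un u∈) (tail≢ un w∈) walk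
        where
        nb : ∀ {t} → (c , t) ∈ S → t ≢ v × Conn c M a t
        nb (here refl)               = x≢v , a~x
        nb (there (here refl))       = y≢v , a~y
        nb (there (there (here eq))) = contradiction (sym (cong proj₁ eq)) (not≢ c)
      ... | no c≢d with ≢⇒≡not c≢d
      ...   | refl = contract S av z nb sub (tail≢ un u∈) (tail≢ un w∈) walk
        where
        nb : ∀ {t} → (not c , t) ∈ S → t ≢ v × Conn (not c) M z t
        nb (here eq)                   = contradiction (cong proj₁ eq) (not≢ c)
        nb (there (here eq))           = contradiction (cong proj₁ eq) (not≢ c)
        nb (there (there (here refl))) = z≢v , ε

    -- Without `v`, colour `c` falls apart into the part of `x` and the part of `y`. Along the walk
    -- it is enough to remember which part was entered last.
    side : ∀ {v c x y z w L₀} → Avoids v L₀ → w ≢ v →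
           Conn c ((c , v , x) ∷ (c , v , y) ∷ (not c , v , z) ∷ L₀) x w →
           Conn c L₀ x w ⊎ Conn c L₀ y w
    side {v} {c} {x} {y} {z} {w} {L₀} av w≢v walk with go (inj₂ (inj₁ ε)) walk
      where
      P : A → Set
      P u = u ≡ v ⊎ Conn c L₀ x u ⊎ Conn c L₀ y u
      S = (c , x) ∷ (c , y) ∷ (not c , z) ∷ []
      nbr : ∀ {t} → (c , t) ∈ S → P t
      nbr (here refl)               = inj₂ (inj₁ ε)
      nbr (there (here refl))       = inj₂ (inj₂ ε)
      nbr (there (there (here eq))) = contradiction (sym (cong proj₁ eq)) (not≢ c)
      go : ∀ {u w} → P u → Conn c (star v S ++ L₀) u w → P w
      go pu ε = pu
      go pu (a ◅ walk) with Adj-star S a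
      ... | inj₁ (t , t∈ , inj₁ (_ , refl)) = go (nbr t∈) walk
      ... | inj₁ (t , t∈ , inj₂ (_ , refl)) = go (inj₁ refl) walk
      ... | inj₂ a′ with pu
      ...   | inj₁ refl      = contradiction refl (proj₁ (Avoids-Adj av a′))
      ...   | inj₂ (inj₁ xu) = go (inj₂ (inj₁ (xu ◅◅ return a′))) walk
      ...   | inj₂ (inj₂ yu) = go (inj₂ (inj₂ (yu ◅◅ return a′))) walk
    ... | inj₁ w≡v = contradiction w≡v w≢v
    ... | inj₂ h   = h

    -- If `z` is light, the path x-v-y is spliced and `z` is the vertex disturbed. Otherwise `z`
    -- lies, in colour `c`, on the side of `x` or of `y`. If that vertex is light, the path from `z`
    -- through `v` to the other one is spliced instead, as the new edge joins the two sides again.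
    three-vertex : ∀ {v c x y z L₀ V₀} → V ↭ v ∷ V₀ →
      L ≈ (c , v , x) ∷ (c , v , y) ∷ (not c , v , z) ∷ L₀ → Avoids v L₀ →
      x ≢ v → y ≢ v → z ≢ v →
      Solution V L ⊎ (9 ≤ D z × (9 ≤ D x ⊎ 9 ≤ D y))
    three-vertex {v} {c} {x} {y} {z} {L₀} {V₀} V↭ L≈ av x≢v y≢v z≢v with D z ≤? 8
    ... | yes z-low = inj₁ (Solution-resp V↭ L≈ (reduce₃ {c = c} (Shape-resp V↭ L≈ sh) av x≢v y≢v z≢v
      (merge-connected V↭ L≈ av x≢v y≢v z≢v (return ∘ next) ε (return fwd))
      (subst (_≤ 8) (W-≈ one L≈ z) z-low) (ih₁ V↭)))
    ... | no z-high with side av z≢v (Connected-resp V↭ L≈ con c (there x∈) (there z∈))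
      where
      ends₊ = within (Shape-resp V↭ L≈ sh)
      x∈ : x ∈ V₀
      x∈ = untail (proj₂ (All.head ends₊)) x≢v
      z∈ : z ∈ V₀
      z∈ = untail (proj₂ (All.head (All.tail (All.tail ends₊)))) z≢v
    ...   | xy~z = Sum.map₂ (≰⇒> z-high ,_)
            ([ Sum.map₂ inj₁ ∘ decide L≈ x≢v y≢v , Sum.map₂ inj₂ ∘ decide (≈-trans L≈ (swap _ _ ≈-refl)) y≢v x≢v ]′ xy~z)
      where
      -- x and z are on the same side of v, so v may be attached to x only by the other colour
      decide : ∀ {x y} → L ≈ (c , v , x) ∷ (c , v , y) ∷ (not c , v , z) ∷ L₀ → x ≢ v → y ≢ v →
               Conn c L₀ x z → Solution V L ⊎ 9 ≤ D x
      decide {x} {y} L≈ x≢v y≢v x~z with D x ≤? 8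
      ... | no x-high = inj₂ (≰⇒> x-high)
      ... | yes x-low = inj₁ (Solution-resp V↭ e (reduce₃ {c = c} (Shape-resp V↭ e sh) av z≢v y≢v x≢v
        (merge-connected V↭ L≈ av x≢v y≢v z≢v (return ∘ next)
          (Conn-⊆ (return ∘ next) (Conn-sym x~z)) (return fwd))
        (subst (_≤ 8) (W-≈ one e x) x-low) (ih₁ V↭)))
        where
        e : L ≈ (not c , v , z) ∷ (c , v , y) ∷ (c , v , x) ∷ L₀
        e = ≈-trans L≈ (≈-trans (prep _ (swap _ _ ≈-refl)) (≈-trans (swap _ _ ≈-refl) (prep _ (swap _ _ ≈-refl))))

    two : Weight
    two _ _ y = is2 (D y)

    -- At most 1 is paid along each half-edge and 1 more to at most one neighbour of degree 2, hence
    -- d + 1 in all; this is within 2d - 8 because d is at least 9.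
    heavy-fair : ∀ {v} → 9 ≤ D v → W two L v ≤ 1 → Fair L v
    heavy-fair {v} h le = begin
      8 + W (outgoing L) L v              ≤⟨ +-monoʳ-≤ 8 (W-mono L v (λ _ y → toll≤ (D v) (D y))) ⟩
      8 + W (λ c x y → 1 + two c x y) L v ≡⟨ cong (8 +_) (W-+ one two L v) ⟩
      8 + (D v + W two L v)               ≤⟨ +-monoʳ-≤ 8 (+-monoʳ-≤ (D v) le) ⟩
      8 + (D v + 1)                       ≡⟨ shuffle (D v) ⟩
      9 + D v                             ≤⟨ +-monoˡ-≤ (D v) h ⟩
      D v + D v                           ≡⟨ double (D v) ⟩
      2 * D v                             ≤⟨ m≤m+n _ _ ⟩
      2 * D v + W (incoming L) L v        ∎
      where
      open ≤-Reasoning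
      shuffle : ∀ d → 8 + (d + 1) ≡ 9 + d
      shuffle = solve-∀
      double : ∀ d → d + d ≡ 2 * d
      double = solve-∀

    is2≤1 : ∀ d → is2 d ≤ 1
    is2≤1 0 = z≤n
    is2≤1 1 = z≤n
    is2≤1 2 = ≤-refl
    is2≤1 (suc (suc (suc _))) = z≤n

    high≢two : ∀ {u x} → 9 ≤ D u → D x ≡ 2 → u ≢ x
    high≢two h two refl = 1+n≰n (≤-trans (subst (9 ≤_) two h) (s≤s (s≤s (z≤n {6}))))

    -- Unless `reduce₁` already applies, the other neighbours `p` and `q` of `x` and `y` are heavy.
    -- So they differ from `x` and `y`, which have degree 2, and `reduce₂` can splice p-x-v and
    -- v-y-q.
    two-twos : ∀ {v} → 9 ≤ D v → 2 ≤ W two L v → Solution V L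
    two-twos {v} h le with extract-W two L v (≤-trans (s≤s z≤n) le)
    ... | c , x , L₁ , e₁ , pos₁ with is2-pos (D x) pos₁
    ...   | dx≡2 with extract-W two L₁ v rest
      where
      v≢x = high≢two h dx≡2
      rest : 1 ≤ W two L₁ v
      rest = +-cancelˡ-≤ 1 _ _ (begin
        2                                                        ≤⟨ le ⟩
        W two L v                                                ≡⟨ W-≈ two e₁ v ⟩
        on v v (is2 (D x)) + on x v (is2 (D v)) + W two L₁ v     ≡⟨ cong₂ (λ a b → a + b + W two L₁ v) (on-refl v {is2 (D x)}) (on-≢ {k = is2 (D v)} (≢-sym v≢x)) ⟩
        is2 (D x) + 0 + W two L₁ v                               ≡⟨ cong (_+ W two L₁ v) (+-identityʳ (is2 (D x))) ⟩
        is2 (D x) + W two L₁ v                                   ≤⟨ +-monoˡ-≤ (W two L₁ v) (is2≤1 (D x)) ⟩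
        1 + W two L₁ v                                           ∎)
        where open ≤-Reasoning
    ...     | d , y , L₂ , e₂ , pos₂ with is2-pos (D y) pos₂
    ...       | dy≡2 = at-two (x ≟ y)
      where
      v≢x = high≢two h dx≡2
      v≢y = high≢two h dy≡2
      e : L ≈ (c , x , v) ∷ (d , y , v) ∷ L₂
      e = ≈-trans e₁ (≈-trans (flip c v x e₂) (prep _ (flip d v y ≈-refl)))
      x∈ : x ∈ V
      x∈ = proj₁ (All.head (within (Shape-resp ↭-refl e sh)))
      y∈ : y ∈ V
      y∈ = proj₁ (All.head (All.tail (within (Shape-resp ↭-refl e sh))))
      at-two : Dec (x ≡ y) → Solution V L
      -- Both edges of `x` lead to `v`, so `two-vertex` cannot answer with distinct neighbours.
      at-two (yes refl) with two-vertex (proj₂ (∈⇒↭ x∈)) e (deg≡0⇒Avoids L₂ deg₀) v≢x v≢x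
        where
        deg₀ : degree L₂ x ≡ 0
        deg₀ = suc-injective (suc-injective (trans (sym (trans (W-≈ one e x)
          (trans (deg-cons c ((d , x , v) ∷ L₂) v≢x) (cong suc (deg-cons d L₂ v≢x))))) dx≡2))
      ... | inj₁ sol                 = sol
      ... | inj₂ (_ , v≢v , _)       = contradiction refl v≢v
      at-two (no x≢y) with extract-last L₂ x deg₁
        where
        deg₁ : degree L₂ x ≡ 1
        deg₁ = suc-injective (trans (sym (trans (W-≈ one e x)
          (trans (deg-cons c ((d , y , v) ∷ L₂) v≢x) (cong suc (deg-skip d L₂ (≢-sym x≢y) v≢x))))) dx≡2)
      ... | f , p , L₃ , e₃ , p≢x , avx
        with two-vertex (proj₂ (∈⇒↭ x∈)) e′ ((≢-sym x≢y , v≢x) ∷ avx) p≢x v≢x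
        where
        e′ : L ≈ (f , x , p) ∷ (c , x , v) ∷ (d , y , v) ∷ L₃
        e′ = ≈-trans e (≈-trans (prep _ (prep _ e₃)) (≈-trans (prep _ (swap _ _ ≈-refl)) (swap _ _ ≈-refl)))
      ...   | inj₁ sol = sol
      ...   | inj₂ (refl , p≢v , hp , _) with extract-last L₃ y deg₁
        where
        e′ : L ≈ (f , x , p) ∷ (not f , x , v) ∷ (d , y , v) ∷ L₃
        e′ = ≈-trans e (≈-trans (prep _ (prep _ e₃)) (≈-trans (prep _ (swap _ _ ≈-refl)) (swap _ _ ≈-refl)))
        deg₁ : degree L₃ y ≡ 1
        deg₁ = suc-injective (trans (sym (trans (W-≈ one e′ y)
          (trans (deg-skip f ((not f , x , v) ∷ (d , y , v) ∷ L₃) x≢y (high≢two hp dy≡2)) (trans (deg-skip (not f) ((d , y , v) ∷ L₃) x≢y v≢y) (deg-cons d L₃ v≢y))))) dy≡2)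
      ...     | g , q , L₄ , e₄ , q≢y , avy
        with two-vertex (proj₂ (∈⇒↭ y∈)) e″ ((x≢y , high≢two hp dy≡2) ∷ (x≢y , v≢y) ∷ avy) v≢y q≢y
        where
        e″ : L ≈ (d , y , v) ∷ (g , y , q) ∷ (f , x , p) ∷ (not f , x , v) ∷ L₄
        e″ = ≈-trans e (≈-trans (prep _ (prep _ e₃)) (≈-trans (prep _ (swap _ _ ≈-refl)) (≈-trans (swap _ _ ≈-refl)
          (≈-trans (prep _ (prep _ (prep _ e₄))) (swap₂ _ _ _ _)))))
      ...       | inj₁ sol = sol
      ...       | inj₂ (refl , _ , _ , hq) = Solution-resp V↭ e‴
        (reduce₂ (Shape-resp V↭ e‴ sh) (Connected-resp V↭ e‴ con) avx′ avy
          p≢x (high≢two hp dy≡2) v≢x v≢y (high≢two hq dx≡2) q≢y (ih _ (≤-reflexive (sym (↭-length V↭)))))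
        where
        e‴ : L ≈ (f , x , p) ∷ (not f , x , v) ∷ (d , y , v) ∷ (not d , y , q) ∷ L₄
        e‴ = ≈-trans e (≈-trans (prep _ (prep _ e₃)) (≈-trans (prep _ (swap _ _ ≈-refl)) (≈-trans (swap _ _ ≈-refl)
          (prep _ (prep _ (prep _ e₄))))))
        avx′ : Avoids x L₄
        avx′ = All.tail (ends-≈ {_≢ x} e₄ avx)
        splitx = ∈⇒↭ x∈
        splity = ∈⇒↭ (untail (∈-resp-↭ (proj₂ splitx) y∈) (≢-sym x≢y))
        V↭ : V ↭ y ∷ x ∷ proj₁ splity
        V↭ = ↭-trans (proj₂ splitx) (↭-trans (prep x (proj₂ splity)) (swap x y ↭-refl))

    light-fair : ∀ {v k} → D v ≤ 8 → 8 ≤ 2 * D v + k → k ≤ W (incoming L) L v → Fair L v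
    light-fair {v} {k} l le in≥ = begin
      8 + W (outgoing L) L v        ≡⟨ cong (8 +_) (W-zero L v (λ _ y → toll-low (D y) l)) ⟩
      8                             ≤⟨ le ⟩
      2 * D v + k                   ≤⟨ +-monoʳ-≤ (2 * D v) in≥ ⟩
      2 * D v + W (incoming L) L v  ∎
      where open ≤-Reasoning

    toll-in : ∀ {x v} → 9 ≤ D x → pay (D v) ≤ toll (D x) (D v)
    toll-in h = ≤-reflexive (sym (toll-high _ h))

    step : ∀ {v u} → v ∈ V → u ∈ V → u ≢ v → Solution V L ⊎ Fair L v
    step {v} {u} v∈ u∈ u≢v with D v ≤? 8 | W two L v ≤? 1
    ... | no h | yes le = inj₂ (heavy-fair (≰⇒> h) le)
    ... | no h | no nle = inj₁ (two-twos (≰⇒> h) (≰⇒> nle))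
    ... | yes l | _ with normal-form con v∈ u∈ u≢v | ∈⇒↭ v∈
    ...   | p , q , L₀ , p≢v , q≢v , e | V₀ , V↭ = by (degree L₀ v) refl
      where
      three-fair : D v ≡ 3 → ∀ {c x y z L₃} → L ≈ (c , v , x) ∷ (c , v , y) ∷ (not c , v , z) ∷ L₃ →
                   Avoids v L₃ → x ≢ v → y ≢ v → z ≢ v → Solution V L ⊎ Fair L v
      three-fair d≡3 {c} {x} {y} {z} e₃ av x≢v y≢v z≢v with three-vertex V↭ e₃ av x≢v y≢v z≢v
      ... | inj₁ sol = inj₁ sol
      ... | inj₂ (hz , hxy) = inj₂ (light-fair {v} {2} l (≤-reflexive (cong (λ d → 2 * d + 2) (sym d≡3)))
        (≤-trans (two≤ hxy) (≤-reflexive (sym (trans (W-≈ (incoming L) e₃ v)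
          (W-star (incoming L) ((c , x) ∷ (c , y) ∷ (not c , z) ∷ []) (x≢v ∷ y≢v ∷ z≢v ∷ []) av))))))
        where
        t : A → ℕ
        t u = toll (D u) (D v)
        one≤ : ∀ {u} → 9 ≤ D u → 1 ≤ t u
        one≤ {u} hu = ≤-trans (≤-reflexive (cong pay (sym d≡3))) (toll-in {u} {v} hu)
        two≤ : 9 ≤ D x ⊎ 9 ≤ D y → 2 ≤ t x + (t y + (t z + 0))
        two≤ (inj₁ hx) = +-mono-≤ (one≤ {x} hx) (≤-trans (+-monoˡ-≤ 0 (one≤ {z} hz)) (m≤n+m _ (t y)))
        two≤ (inj₂ hy) = ≤-trans (+-mono-≤ (one≤ {y} hy) (+-monoˡ-≤ 0 (one≤ {z} hz))) (m≤n+m _ (t x))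
      D-v : D v ≡ 2 + degree L₀ v
      D-v = trans (W-≈ one e v) (trans (deg-cons true ((false , v , q) ∷ L₀) p≢v) (cong suc (deg-cons false L₀ q≢v)))
      by : ∀ k → degree L₀ v ≡ k → Solution V L ⊎ Fair L v
      by 0 eq with two-vertex V↭ e (deg≡0⇒Avoids L₀ eq) p≢v q≢v
      ... | inj₁ sol = inj₁ sol
      ... | inj₂ (_ , _ , hp , hq) = inj₂ (light-fair {v} {4} l
        (≤-reflexive (cong (λ d → 2 * d + 4) (sym Dv≡2)))
        (≤-trans (≤-reflexive (cong (λ d → pay d + (pay d + 0)) (sym Dv≡2))) (≤-trans
          (+-mono-≤ (toll-in {p} {v} hp) (+-monoˡ-≤ 0 (toll-in {q} {v} hq)))
          (≤-reflexive (sym (trans (W-≈ (incoming L) e v)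
            (W-star (incoming L) ((true , p) ∷ (false , q) ∷ []) (p≢v ∷ q≢v ∷ []) (deg≡0⇒Avoids L₀ eq))))))))
        where
        Dv≡2 : D v ≡ 2
        Dv≡2 = trans D-v (cong (2 +_) eq)
      -- Degree 3: the colour of the third edge decides which colour occurs twice at `v`; that pair
      -- goes first.
      by 1 eq with extract-last L₀ v eq
      ... | true  , r , L₃ , e₃ , r≢v , av =
        three {true} (≈-trans e (prep _ (≈-trans (prep _ e₃) (swap _ _ ≈-refl)))) av p≢v r≢v q≢v
        where three = three-fair (trans D-v (cong (2 +_) eq))
      ... | false , r , L₃ , e₃ , r≢v , av =
        three {false} (≈-trans e (≈-trans (swap _ _ ≈-refl) (prep _ (≈-trans (prep _ e₃) (swap _ _ ≈-refl))))) av q≢v r≢v p≢v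
        where three = three-fair (trans D-v (cong (2 +_) eq))
      -- Degree at least 4: the initial charge is not negative and, `v` being light, nothing is
      -- paid.
      by (suc (suc k)) eq = inj₂ (light-fair {v} {0} l
        (≤-trans (≤-trans (≤-trans (*-monoʳ-≤ 2 (m≤m+n 4 k)) (≤-reflexive (cong (λ d → 2 * (2 + d)) (sym eq)))) (≤-reflexive (cong (2 *_) (sym D-v)))) (m≤m+n _ 0)) z≤n)

  -- The total charge and the induction on the number of vertices

  total : Weight → List Edge → ℕ
  total g []                = 0
  total g ((c , x , y) ∷ L) = g c x y + g c y x + total g L

  handshake : ∀ g {V} L → Unique V → AllEnds (_∈ V) L →
              Σ (W g L) V ≡ total g L
  handshake g {V} []                un []               = Σ-const 0 V
  handshake g {V} ((c , x , y) ∷ L) un ((x∈ , y∈) ∷ es) =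
    trans (Σ-+ _ _ V) (cong₂ _+_
      (trans (Σ-+ _ _ V) (cong₂ _+_ (Σ-on (g c x y) un x∈) (Σ-on (g c y x) un y∈)))
      (handshake g L un es))

  total-reverse : ∀ g L → total (λ c x y → g c y x) L ≡ total g L
  total-reverse g []                = refl
  total-reverse g ((c , x , y) ∷ L) = cong₂ _+_ (+-comm (g c y x) (g c x y)) (total-reverse g L)

  total-one : ∀ L → total one L ≡ 2 * length L
  total-one []      = refl
  total-one (e ∷ L) = trans (cong (2 +_) (total-one L)) (sym (*-suc 2 (length L)))

  -- Payments only move charge between vertices, so the sum stays 4|E| - 8n, which is at most -8 by
  -- `size`.
  not-all-fair : ∀ {V L} → Shape V L → ¬ All (Fair L) V
  not-all-fair {V} {L} (shape un es sz) fair = 1+n≰n (begin-strict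
    8 * length V              ≤⟨ +-cancelʳ-≤ T _ _ charge ⟩
    2 * (2 * length L)        <⟨ m<n+m _ {8} (s≤s z≤n) ⟩
    8 + 2 * (2 * length L)    ≡⟨ regroup (length L) ⟩
    4 * (2 + length L)        ≤⟨ *-monoʳ-≤ 4 sz ⟩
    4 * (2 * length V)        ≡⟨ *-assoc 4 2 (length V) ⟨
    8 * length V              ∎)
    where
    open ≤-Reasoning
    T = total (outgoing L) L
    regroup : ∀ l → 8 + 2 * (2 * l) ≡ 4 * (2 + l)
    regroup = solve-∀
    charge : 8 * length V + T ≤ 2 * (2 * length L) + T
    charge = begin
      8 * length V + T                                          ≡⟨ cong₂ _+_ (Σ-const 8 V) (handshake (outgoing L) L un es) ⟨
      Σ (λ _ → 8) V + Σ (W (outgoing L) L) V                    ≡⟨ Σ-+ _ _ V ⟨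
      Σ (λ v → 8 + W (outgoing L) L v) V                        ≤⟨ Σ-mono V fair ⟩
      Σ (λ v → 2 * degree L v + W (incoming L) L v) V              ≡⟨ Σ-+ _ _ V ⟩
      Σ (λ v → 2 * degree L v) V + Σ (W (incoming L) L) V          ≡⟨ cong₂ _+_ (Σ-* 2 (degree L) V) (handshake (incoming L) L un es) ⟩
      2 * Σ (degree L) V + total (incoming L) L                    ≡⟨ cong₂ (λ a b → 2 * a + b) (trans (handshake one L un es) (total-one L)) (total-reverse (outgoing L) L) ⟩
      2 * (2 * length L) + T                                    ∎

  any-or-all : ∀ {P : A → Set} {Q : Set} V → (∀ {v} → v ∈ V → Q ⊎ P v) → Q ⊎ All P V
  any-or-all []      h = inj₂ []
  any-or-all (v ∷ V) h with h (here refl) | any-or-all V (h ∘ there)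
  ... | inj₁ q | _       = inj₁ q
  ... | inj₂ _ | inj₁ q  = inj₁ q
  ... | inj₂ p | inj₂ ps = inj₂ (p ∷ ps)

  solve-upto : ∀ n V → length V < n → Solvable V
  solve-upto zero    V              ()
  -- `size` excludes the empty vertex list, and for a single vertex it leaves no edges.
  solve-upto (suc n) []             lt L (shape _ _ ()) con
  solve-upto (suc n) (v ∷ [])       lt []      sh con = [] , [] , con , λ _ _ → z≤n
  solve-upto (suc n) (v ∷ [])       lt (e ∷ L) (shape _ _ (s≤s (s≤s ()))) con
  solve-upto (suc n) V@(v ∷ u ∷ V₀) lt L       sh con with any-or-all V fair
    where
    u≢v : u ≢ v
    u≢v = tail≢ (unique sh) (here refl)
    open Step V L sh con (λ V′ lt′ → solve-upto n V′ (≤-trans lt′ (≤-pred lt)))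
    fair : ∀ {w} → w ∈ V → Solution V L ⊎ Fair L w
    fair {w} w∈ with w ≟ v
    ... | yes refl = step w∈ (there (here refl)) u≢v
    ... | no w≢v   = step w∈ (here refl) (≢-sym w≢v)
  ... | inj₁ sol = sol
  ... | inj₂ all = contradiction all (not-all-fair sh)

  solvable : ∀ V → Solvable V
  solvable V = solve-upto (suc (length V)) V ≤-refl

-- Levelling k trees

-- `d` differs from the mean `S / N` by at most `f`, with the denominator cleared.
Near : ℕ → ℕ → ℕ → ℕ → Set
Near f N S d = N * d ≤ S + N * f × S ≤ N * d + N * f

-- `i′` and `j′` have the sum of `i` and `j` and differ by at most 6, so each is within 3 of (i + j)
-- / 2, which is within `f` of the joint mean (S + T) / 2a.
near-double : ∀ {f a S T i j i′ j′} → Near f a S i → Near f a T j →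
              i′ + j′ ≡ i + j → i′ ≤ 6 + j′ → j′ ≤ 6 + i′ → Near (f + 3) (a * 2) (S + T) i′
near-double {f} {a} {S} {T} {i} {j} {i′} {j′} (iu , il) (ju , jl) eq le ge = upper , lower
  where
  open ≤-Reasoning
  upper : a * 2 * i′ ≤ S + T + a * 2 * (f + 3)
  upper = begin
    a * 2 * i′                            ≡⟨ e₁ a i′ ⟩
    a * (i′ + i′)                         ≤⟨ *-monoʳ-≤ a (+-monoʳ-≤ i′ le) ⟩
    a * (i′ + (6 + j′))                   ≡⟨ e₂ a i′ j′ ⟩
    a * (6 + (i′ + j′))                   ≡⟨ cong (λ s → a * (6 + s)) eq ⟩
    a * (6 + (i + j))                     ≡⟨ e₃ a i j ⟩
    a * 6 + (a * i + a * j)               ≤⟨ +-monoʳ-≤ (a * 6) (+-mono-≤ iu ju) ⟩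
    a * 6 + (S + a * f + (T + a * f))     ≡⟨ e₄ a f S T ⟩
    S + T + a * 2 * (f + 3)               ∎
    where
    e₁ : ∀ a i → a * 2 * i ≡ a * (i + i)
    e₁ = solve-∀
    e₂ : ∀ a i j → a * (i + (6 + j)) ≡ a * (6 + (i + j))
    e₂ = solve-∀
    e₃ : ∀ a i j → a * (6 + (i + j)) ≡ a * 6 + (a * i + a * j)
    e₃ = solve-∀
    e₄ : ∀ a f S T → a * 6 + (S + a * f + (T + a * f)) ≡ S + T + a * 2 * (f + 3)
    e₄ = solve-∀
  lower : S + T ≤ a * 2 * i′ + a * 2 * (f + 3)
  lower = begin
    S + T                                     ≤⟨ +-mono-≤ il jl ⟩
    a * i + a * f + (a * j + a * f)           ≡⟨ e₁ a f i j ⟩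
    a * (i + j) + a * 2 * f                   ≡⟨ cong (λ s → a * s + a * 2 * f) eq ⟨
    a * (i′ + j′) + a * 2 * f                 ≤⟨ +-monoˡ-≤ (a * 2 * f) (*-monoʳ-≤ a (+-monoʳ-≤ i′ ge)) ⟩
    a * (i′ + (6 + i′)) + a * 2 * f           ≡⟨ e₂ a f i′ ⟩
    a * 2 * i′ + a * 2 * (f + 3)              ∎
    where
    e₁ : ∀ a f i j → a * i + a * f + (a * j + a * f) ≡ a * (i + j) + a * 2 * f
    e₁ = solve-∀
    e₂ : ∀ a f i → a * (i + (6 + i)) + a * 2 * f ≡ a * 2 * i + a * 2 * (f + 3)
    e₂ = solve-∀

-- The gap N x - S, halved up to a bounded error by averaging x with an o
-- that is near S / N, and made strictly smaller as long as it exceeds N (f + 6).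
module Shrink (n f : ℕ) where
  -- If the gap is at most g, one round makes it at most (n g + (N + 1) K) / 2N. `K` is the fixed
  -- point of this map, since n + N + 1 = 2N.
  N K : ℕ
  N = suc n
  K = N * (f + 6)

  -- The part of the gap above `K` is multiplied by n / 2N, hence falls by at least 1; this makes
  -- `t` a measure for recursion.
  shrink-upper : ∀ {x o x′ o′ S S′ t} → N * x ≤ S + (K + suc t) → N * o ≤ S + N * f →
                 x′ + o′ ≡ x + o → x′ ≤ 6 + o′ → S′ + x′ ≡ S + x → N * x′ ≤ S′ + (K + t)
  shrink-upper {x} {o} {x′} {o′} {S} {S′} {t} hx ho eq le eS =
    ≤-pred (subst (N * x′ <_) (e₀ S′ K t) (+-cancelʳ-< x′ _ _ (subst (N * x′ + x′ <_) tidy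
      (*-cancelˡ-< (2 * N) _ _ main))))
    where
    open ≤-Reasoning
    e₀ : ∀ S K t → S + K + suc t ≡ suc (S + (K + t))
    e₀ = solve-∀
    tidy : S + x + K + suc t ≡ S′ + K + suc t + x′
    tidy = trans (cong (λ s → s + K + suc t) (sym eS)) (e S′ x′ K t)
      where
      e : ∀ S x K t → S + x + K + suc t ≡ S + K + suc t + x
      e = solve-∀
    main : 2 * N * (N * x′ + x′) < 2 * N * (S + x + K + suc t)
    main = begin-strict
      2 * N * (N * x′ + x′)                                                     ≡⟨ e₁ n x′ ⟩
      N * suc N * (x′ + x′)                                                     ≤⟨ *-monoʳ-≤ (N * suc N) (+-monoʳ-≤ x′ le) ⟩
      N * suc N * (x′ + (6 + o′))                                               ≡⟨ cong (N * suc N *_) (e₂ x′ o′) ⟩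
      N * suc N * (6 + (x′ + o′))                                               ≡⟨ cong (λ s → N * suc N * (6 + s)) eq ⟩
      -- Of the `N * suc N` copies of `x`, `2 * N` stay to form `S + x`, which the exchange
      -- preserves; the others are bounded through `hx`.
      N * suc N * (6 + (x + o))                                                 ≡⟨ e₃ n x o ⟩
      N * suc N * 6 + 2 * N * x + (n * (N * x) + suc N * (N * o))               ≤⟨ +-monoʳ-≤ (N * suc N * 6 + 2 * N * x) (+-mono-≤ (*-monoʳ-≤ n hx) (*-monoʳ-≤ (suc N) ho)) ⟩
      N * suc N * 6 + 2 * N * x + (n * (S + (K + suc t)) + suc N * (S + N * f)) ≡⟨ e₄ n f x S t ⟩
      2 * N * (S + x + K) + n * suc t                                           <⟨ +-monoʳ-< (2 * N * (S + x + K)) (*-monoˡ-< (suc t) (m≤m+n N (N + 0))) ⟩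
      2 * N * (S + x + K) + 2 * N * suc t                                       ≡⟨ *-distribˡ-+ (2 * N) (S + x + K) (suc t) ⟨
      2 * N * (S + x + K + suc t)                                               ∎
      where
      e₁ : ∀ n x → 2 * suc n * (suc n * x + x) ≡ suc n * suc (suc n) * (x + x)
      e₁ = solve-∀
      e₂ : ∀ x o → x + (6 + o) ≡ 6 + (x + o)
      e₂ = solve-∀
      e₃ : ∀ n x o → suc n * suc (suc n) * (6 + (x + o)) ≡
           suc n * suc (suc n) * 6 + 2 * suc n * x + (n * (suc n * x) + suc (suc n) * (suc n * o))
      e₃ = solve-∀
      e₄ : ∀ n f x S t → suc n * suc (suc n) * 6 + 2 * suc n * x +
           (n * (S + (suc n * (f + 6) + suc t)) + suc (suc n) * (S + suc n * f)) ≡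
           2 * suc n * (S + x + suc n * (f + 6)) + n * suc t
      e₄ = solve-∀

  shrink-lower : ∀ {x o x′ o′ S S′ t} → S ≤ N * x + (K + suc t) → S ≤ N * o + N * f →
                 x′ + o′ ≡ x + o → o′ ≤ 6 + x′ → S′ + x′ ≡ S + x → S′ ≤ N * x′ + (K + t)
  shrink-lower {x} {o} {x′} {o′} {S} {S′} {t} hx ho eq le eS =
    ≤-pred (subst (S′ <_) (e₀ (N * x′) K t) (+-cancelʳ-< x′ _ _ (subst₂ _<_ (sym eS) (e₅ (N * x′) x′ K t)
      (*-cancelˡ-< (2 * N) _ _ main))))
    where
    open ≤-Reasoning
    e₀ : ∀ S K t → S + K + suc t ≡ suc (S + (K + t))
    e₀ = solve-∀
    e₅ : ∀ a x K t → a + x + K + suc t ≡ a + K + suc t + x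
    e₅ = solve-∀
    main : 2 * N * (S + x) < 2 * N * (N * x′ + x′ + K + suc t)
    main = begin-strict
      2 * N * (S + x)                                                               ≡⟨ e₁ n x S ⟩
      2 * N * x + (n * S + suc N * S)                                               ≤⟨ +-monoʳ-≤ (2 * N * x) (+-mono-≤ (*-monoʳ-≤ n hx) (*-monoʳ-≤ (suc N) ho)) ⟩
      2 * N * x + (n * (N * x + (K + suc t)) + suc N * (N * o + N * f))             ≡⟨ e₂ n f x o K t ⟩
      N * suc N * (x + o) + (n * K + suc N * (N * f) + n * suc t)                   ≡⟨ cong (λ s → N * suc N * s + (n * K + suc N * (N * f) + n * suc t)) eq ⟨
      N * suc N * (x′ + o′) + (n * K + suc N * (N * f) + n * suc t)                 ≤⟨ +-monoˡ-≤ (n * K + suc N * (N * f) + n * suc t) (*-monoʳ-≤ (N * suc N) (+-monoʳ-≤ x′ le)) ⟩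
      N * suc N * (x′ + (6 + x′)) + (n * K + suc N * (N * f) + n * suc t)           ≡⟨ e₃ n f x′ t ⟩
      2 * N * (N * x′ + x′ + K) + n * suc t                                         <⟨ +-monoʳ-< (2 * N * (N * x′ + x′ + K)) (*-monoˡ-< (suc t) (m≤m+n N (N + 0))) ⟩
      2 * N * (N * x′ + x′ + K) + 2 * N * suc t                                     ≡⟨ *-distribˡ-+ (2 * N) (N * x′ + x′ + K) (suc t) ⟨
      2 * N * (N * x′ + x′ + K + suc t)                                             ∎
      where
      e₁ : ∀ n x S → 2 * suc n * (S + x) ≡ 2 * suc n * x + (n * S + suc (suc n) * S)
      e₁ = solve-∀
      e₂ : ∀ n f x o K t → 2 * suc n * x + (n * (suc n * x + (K + suc t)) + suc (suc n) * (suc n * o + suc n * f)) ≡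
           suc n * suc (suc n) * (x + o) + (n * K + suc (suc n) * (suc n * f) + n * suc t)
      e₂ = solve-∀
      e₃ : ∀ n f x t → suc n * suc (suc n) * (x + (6 + x)) +
           (n * (suc n * (f + 6)) + suc (suc n) * (suc n * f) + n * suc t) ≡
           2 * suc n * (suc n * x + x + suc n * (f + 6)) + n * suc t
      e₃ = solve-∀

  -- The new mean (x + S) / (N + 1) is at distance |N x - S| / (N + 1) from `x`, and `K` is below (N
  -- + 1)(f + 6).
  near-x : ∀ {x S} → N * x ≤ S + K → S ≤ N * x + K → Near (f + 6) (suc N) (x + S) x
  near-x {x} {S} u l = upper , lower
    where
    open ≤-Reasoning
    upper : suc N * x ≤ x + S + suc N * (f + 6)
    upper = begin
      x + N * x                     ≤⟨ +-monoʳ-≤ x u ⟩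
      x + (S + K)                   ≡⟨ +-assoc x S K ⟨
      x + S + K                     ≤⟨ +-monoʳ-≤ (x + S) (m≤n+m K (f + 6)) ⟩
      x + S + suc N * (f + 6)       ∎
    lower : x + S ≤ suc N * x + suc N * (f + 6)
    lower = begin
      x + S                         ≤⟨ +-monoʳ-≤ x l ⟩
      x + (N * x + K)               ≡⟨ +-assoc x (N * x) K ⟨
      suc N * x + K                 ≤⟨ +-monoʳ-≤ (suc N * x) (m≤n+m K (f + 6)) ⟩
      suc N * x + suc N * (f + 6)   ∎

  -- Adding `x` moves the mean of the others by at most (f + 6) / (N + 1), which is at most 6
  -- because `f ≤ 6 * N`.
  near-o : ∀ {x o S} → f ≤ 6 * N → N * x ≤ S + K → S ≤ N * x + K → Near f N S o →
           Near (f + 6) (suc N) (x + S) o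
  near-o {x} {o} {S} f≤ u l (ou , ol) = upper , lower
    where
    open ≤-Reasoning
    slack : suc N * f + (f + 6) ≤ suc N * (f + 6)
    slack = begin
      suc N * f + (f + 6)         ≤⟨ +-monoʳ-≤ (suc N * f) (+-monoˡ-≤ 6 f≤) ⟩
      suc N * f + (6 * N + 6)     ≡⟨ e n f ⟩
      suc N * (f + 6)             ∎
      where
      e : ∀ n f → suc (suc n) * f + (6 * suc n + 6) ≡ suc (suc n) * (f + 6)
      e = solve-∀
    upper : suc N * o ≤ x + S + suc N * (f + 6)
    upper = ≤-trans (*-cancelˡ-≤ N (begin
      N * (suc N * o)                                 ≡⟨ e₁ n o ⟩
      suc N * (N * o)                                 ≤⟨ *-monoʳ-≤ (suc N) ou ⟩
      suc N * (S + N * f)                             ≡⟨ e₂ n f S ⟩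
      S + (N * S + N * (suc N * f))                   ≤⟨ +-monoˡ-≤ (N * S + N * (suc N * f)) l ⟩
      N * x + K + (N * S + N * (suc N * f))           ≡⟨ e₃ n f x S ⟩
      N * (x + S + (suc N * f + (f + 6)))             ∎)) (+-monoʳ-≤ (x + S) slack)
      where
      e₁ : ∀ n o → suc n * (suc (suc n) * o) ≡ suc (suc n) * (suc n * o)
      e₁ = solve-∀
      e₂ : ∀ n f S → suc (suc n) * (S + suc n * f) ≡ S + (suc n * S + suc n * (suc (suc n) * f))
      e₂ = solve-∀
      e₃ : ∀ n f x S → suc n * x + suc n * (f + 6) + (suc n * S + suc n * (suc (suc n) * f)) ≡
           suc n * (x + S + (suc (suc n) * f + (f + 6)))
      e₃ = solve-∀
    lower : x + S ≤ suc N * o + suc N * (f + 6)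
    lower = ≤-trans (*-cancelˡ-≤ N (begin
      N * (x + S)                                     ≡⟨ *-distribˡ-+ N x S ⟩
      N * x + N * S                                   ≤⟨ +-monoˡ-≤ (N * S) u ⟩
      S + K + N * S                                   ≡⟨ e₁ n f S ⟩
      suc N * S + K                                   ≤⟨ +-monoˡ-≤ K (*-monoʳ-≤ (suc N) ol) ⟩
      suc N * (N * o + N * f) + K                     ≡⟨ e₂ n f o ⟩
      N * (suc N * o + (suc N * f + (f + 6)))         ∎)) (+-monoʳ-≤ (suc N * o) slack)
      where
      e₁ : ∀ n f S → S + suc n * (f + 6) + suc n * S ≡ suc (suc n) * S + suc n * (f + 6)
      e₁ = solve-∀
      e₂ : ∀ n f o → suc (suc n) * (suc n * o + suc n * f) + suc n * (f + 6) ≡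
           suc n * (suc (suc n) * o + (suc (suc n) * f + (f + 6)))
      e₂ = solve-∀

-- Pairings and the cost of doubling

flat : ∀ {I : Set} → List (I × I) → List I
flat []            = []
flat ((i , j) ∷ Z) = i ∷ j ∷ flat Z

pair-up : ∀ {I : Set} a (C : List I) → length C ≡ a * 2 → ∃ λ Z → length Z ≡ a × C ≡ flat Z
pair-up zero    []          eq = [] , refl , refl
pair-up (suc a) (i ∷ j ∷ C) eq with pair-up a C (suc-injective (suc-injective eq))
... | Z , refl , refl = (i , j) ∷ Z , refl , refl

half : ∀ n → ∃ λ a → n ≡ a * 2 ⊎ n ≡ suc (a * 2)
half zero = 0 , inj₁ refl
half (suc n) with half n
... | a , inj₁ refl = a , inj₂ refl
... | a , inj₂ refl = suc a , inj₁ refl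

*-^ : ∀ a b n → (a * b) ^ n ≡ a ^ n * b ^ n
*-^ a b zero    = refl
*-^ a b (suc n) rewrite *-^ a b n = e a b (a ^ n) (b ^ n)
  where
  e : ∀ a b c d → a * b * (c * d) ≡ a * c * (b * d)
  e = solve-∀

2^-double : ∀ k f e a → 2 ^ f ≤ a ^ k → e ≤ k → 2 ^ (f + e) ≤ (a * 2) ^ k
2^-double k f e a 2^f≤ e≤ = begin
  2 ^ (f + e)        ≡⟨ ^-distribˡ-+-* 2 f e ⟩
  2 ^ f * 2 ^ e      ≤⟨ *-mono-≤ 2^f≤ (^-monoʳ-≤ 2 e≤) ⟩
  a ^ k * 2 ^ k      ≡⟨ *-^ a 2 k ⟨
  (a * 2) ^ k        ∎
  where open ≤-Reasoning

-- ℓ trees are levelled up to f; the linear bound is what near-o requires.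
record Cost (ℓ f : ℕ) : Set where
  constructor cost
  field
    linear : f ≤ 6 * ℓ
    power  : 2 ^ f ≤ ℓ ^ 11

open Cost

cost-double : ∀ {ℓ f} → 1 ≤ ℓ → Cost ℓ f → Cost (ℓ * 2) (f + 3)
cost-double {ℓ} {f} 1≤ℓ (cost f≤ 2^f≤) = cost (begin
    f + 3             ≤⟨ +-mono-≤ f≤ (≤-trans (s≤s (s≤s (s≤s z≤n))) (*-monoʳ-≤ 6 1≤ℓ)) ⟩
    6 * ℓ + 6 * ℓ     ≡⟨ e ℓ ⟩
    6 * (ℓ * 2)       ∎) (2^-double 11 f 3 ℓ 2^f≤ (s≤s (s≤s (s≤s z≤n))))
  where
  open ≤-Reasoning
  e : ∀ l → 6 * l + 6 * l ≡ 6 * (l * 2)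
  e = solve-∀

cost-suc-double : ∀ {ℓ f} → 1 ≤ ℓ → Cost ℓ f → Cost (suc (ℓ * 2)) (f + 3 + 6)
cost-suc-double {ℓ} {f} 1≤ℓ c = cost
    (≤-trans (+-monoˡ-≤ 6 (linear (cost-double 1≤ℓ c))) (≤-reflexive (e (ℓ * 2))))
    -- An odd step costs 3 + 6 = 9, within the 11 units that doubling `ℓ` provides.
    (≤-trans (subst (λ e → 2 ^ e ≤ (ℓ * 2) ^ 11) (sym (+-assoc f 3 6)) (2^-double 11 f 9 ℓ (power c) (m≤m+n 9 2)))
             (^-monoˡ-≤ 11 (n≤1+n (ℓ * 2))))
  where
  e : ∀ l → 6 * l + 6 ≡ 6 * suc l
  e = solve-∀

-- A state s is a factorization, and d s i x the degree of x in its i-th tree.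
module Levelling {St I X : Set} (d : St → I → X → ℕ)
  (bound : ℕ) (d≤bound : ∀ s i x → d s i x ≤ bound)
  (average : ∀ s {i j} → i ≢ j → ∃ λ s′ →
    (∀ x → d s′ i x + d s′ j x ≡ d s i x + d s j x) ×
    (∀ x → d s′ i x ≤ 6 + d s′ j x) × (∀ x → d s′ j x ≤ 6 + d s′ i x) ×
    (∀ {l} → l ≢ i → l ≢ j → ∀ x → d s′ l x ≡ d s l x)) where

  S : St → List I → X → ℕ
  S s C x = Σ (λ i → d s i x) C

  S≤ : ∀ s C x → S s C x ≤ length C * bound
  S≤ s []      x = z≤n
  S≤ s (i ∷ C) x = +-mono-≤ (d≤bound s i x) (S≤ s C x)

  -- Trees outside `C` and the mean over `C` are untouched, so families with no common tree can be
  -- levelled one after the other.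
  Keeps : List I → St → St → Set
  Keeps C s s′ = (∀ {l} → l ∉ C → ∀ x → d s′ l x ≡ d s l x) × (∀ x → S s′ C x ≡ S s C x)

  Level : ℕ → List I → St → Set
  Level f C s = ∀ {i} → i ∈ C → ∀ x → Near f (length C) (S s C x) (d s i x)

  CanLevel : ℕ → List I → Set
  CanLevel f C = ∀ s → ∃ λ s′ → Keeps C s s′ × Level f C s′

  level-singleton : ∀ i → CanLevel 0 (i ∷ [])
  level-singleton i s = s , ((λ _ _ → refl) , (λ _ → refl)) , λ { (here refl) x → ≤-reflexive (e (d s i x)) , ≤-reflexive (e′ (d s i x)) }
    where
    e : ∀ d → 1 * d ≡ d + 0 + 1 * 0
    e = solve-∀
    e′ : ∀ d → d + 0 ≡ 1 * d + 1 * 0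
    e′ = solve-∀

  firsts seconds : List (I × I) → List I
  firsts  = map proj₁
  seconds = map proj₂

  S-flat : ∀ s Z x → S s (flat Z) x ≡ S s (firsts Z) x + S s (seconds Z) x
  S-flat s []            x = refl
  S-flat s ((i , j) ∷ Z) x rewrite S-flat s Z x =
    trans (sym (+-assoc (d s i x) (d s j x) _)) (interchange (d s i x) (d s j x) _ _)

  first∈flat : ∀ {i} Z → i ∈ firsts Z → i ∈ flat Z
  first∈flat ((i , j) ∷ Z) (here refl) = here refl
  first∈flat ((i , j) ∷ Z) (there i∈)  = there (there (first∈flat Z i∈))

  second∈flat : ∀ {i} Z → i ∈ seconds Z → i ∈ flat Z
  second∈flat ((i , j) ∷ Z) (here refl) = there (here refl)
  second∈flat ((i , j) ∷ Z) (there i∈)  = there (there (second∈flat Z i∈))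

  unique-firsts : ∀ Z → Unique (flat Z) → Unique (firsts Z)
  unique-firsts []            un = []
  unique-firsts ((i , j) ∷ Z) ((_ ∷ ni) ∷ _ ∷ un) =
    All.tabulate (λ l∈ → All.lookup ni (first∈flat Z l∈)) ∷ unique-firsts Z un

  unique-seconds : ∀ Z → Unique (flat Z) → Unique (seconds Z)
  unique-seconds []            un = []
  unique-seconds ((i , j) ∷ Z) (_ ∷ nj ∷ un) =
    All.tabulate (λ l∈ → All.lookup nj (second∈flat Z l∈)) ∷ unique-seconds Z un

  firsts#seconds : ∀ {l} Z → Unique (flat Z) → l ∈ firsts Z → l ∉ seconds Z
  firsts#seconds ((i , j) ∷ Z) ((i≢j ∷ _) ∷ _)     (here refl) (here refl) = i≢j refl
  firsts#seconds ((i , j) ∷ Z) ((_ ∷ ni) ∷ _)      (here refl) (there l∈)  = All.lookup ni (second∈flat Z l∈) refl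
  firsts#seconds ((i , j) ∷ Z) (_ ∷ nj ∷ _)        (there l∈)  (here refl) = All.lookup nj (first∈flat Z l∈) refl
  firsts#seconds ((i , j) ∷ Z) (_ ∷ _ ∷ un)        (there l∈)  (there l∈′) = firsts#seconds Z un l∈ l∈′

  Averaged : St → St → I × I → Set
  Averaged s s′ (i , j) = ∀ x → d s′ i x + d s′ j x ≡ d s i x + d s j x ×
                                d s′ i x ≤ 6 + d s′ j x × d s′ j x ≤ 6 + d s′ i x

  average-all : ∀ Z → Unique (flat Z) → ∀ s → ∃ λ s′ →
                (∀ {l} → l ∉ flat Z → ∀ x → d s′ l x ≡ d s l x) × (∀ {z} → z ∈ Z → Averaged s s′ z)
  average-all []            un s = s , (λ _ _ → refl) , λ ()
  average-all ((i , j) ∷ Z) ((i≢j ∷ ni) ∷ nj ∷ un) s with average s i≢j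
  ... | s₁ , sum₁ , le , ge , same₁ with average-all Z un s₁
  ...   | s₂ , same₂ , avg₂ = s₂ ,
    (λ l∉ x → trans (same₂ (l∉ ∘ there ∘ there) x) (same₁ (l∉ ∘ here) (l∉ ∘ there ∘ here) x)) , avg
    where
    i∉ : i ∉ flat Z
    i∉ i∈ = All.lookup ni i∈ refl
    j∉ : j ∉ flat Z
    j∉ j∈ = All.lookup nj j∈ refl
    avg : ∀ {z} → z ∈ (i , j) ∷ Z → Averaged s s₂ z
    avg (here refl) x rewrite same₂ i∉ x | same₂ j∉ x = sum₁ x , le x , ge x
    avg {p , q} (there z∈) x with avg₂ z∈ x
    ... | sum₂ , le₂ , ge₂ = trans sum₂ (cong₂ _+_
        (same₁ (≢-sym (All.lookup ni p∈)) (≢-sym (All.lookup nj p∈)) x)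
        (same₁ (≢-sym (All.lookup ni q∈)) (≢-sym (All.lookup nj q∈)) x)) , le₂ , ge₂
      where
      p∈ : p ∈ flat Z
      p∈ = first∈flat Z (∈-map⁺ proj₁ z∈)
      q∈ : q ∈ flat Z
      q∈ = second∈flat Z (∈-map⁺ proj₂ z∈)

  S-averaged : ∀ {s s′} Z x → (∀ {z} → z ∈ Z → Averaged s s′ z) → S s′ (flat Z) x ≡ S s (flat Z) x
  S-averaged []            x avg = refl
  S-averaged {s} {s′} ((i , j) ∷ Z) x avg = begin
    d s′ i x + (d s′ j x + S s′ (flat Z) x)  ≡⟨ +-assoc (d s′ i x) _ _ ⟨
    d s′ i x + d s′ j x + S s′ (flat Z) x    ≡⟨ cong₂ _+_ (proj₁ (avg (here refl) x)) (S-averaged Z x (avg ∘ there)) ⟩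
    d s i x + d s j x + S s (flat Z) x       ≡⟨ +-assoc (d s i x) _ _ ⟩
    d s i x + (d s j x + S s (flat Z) x)     ∎
    where open ≡-Reasoning

  flat-split : ∀ {l} (Z : List (I × I)) → l ∈ flat Z → ∃ λ z → z ∈ Z × (l ≡ proj₁ z ⊎ l ≡ proj₂ z)
  flat-split (z ∷ Z) (here refl)         = z , here refl , inj₁ refl
  flat-split (z ∷ Z) (there (here refl)) = z , here refl , inj₂ refl
  flat-split (z ∷ Z) (there (there l∈)) with flat-split Z l∈
  ... | z′ , z∈ , h = z′ , there z∈ , h

  length-flat : ∀ (Z : List (I × I)) → length (flat Z) ≡ length Z * 2
  length-flat []      = refl
  length-flat (z ∷ Z) = cong (suc ∘ suc) (length-flat Z)

  -- Each pair takes one member from either half. The halves are disjoint, so levelling `seconds`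
  -- leaves `firsts` level, and the pairs are averaged independently.
  level-double : ∀ {f} Z → Unique (flat Z) → CanLevel f (firsts Z) → CanLevel f (seconds Z) →
                 CanLevel (f + 3) (flat Z)
  level-double {f} Z un levelA levelB s with levelA s
  ... | s₁ , (keep₁ , sum₁) , lev₁ with levelB s₁
  ...   | s₂ , (keep₂ , sum₂) , lev₂ with average-all Z un s₂
  ...     | s₃ , keep₃ , avg = s₃ , (keep , sums) , lev
    where
    A = firsts Z
    B = seconds Z
    open ≡-Reasoning
    keep : ∀ {l} → l ∉ flat Z → ∀ x → d s₃ l x ≡ d s l x
    keep l∉ x = trans (keep₃ l∉ x) (trans (keep₂ (l∉ ∘ second∈flat Z) x) (keep₁ (l∉ ∘ first∈flat Z) x))
    A-same : ∀ {i} → i ∈ A → ∀ x → d s₂ i x ≡ d s₁ i x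
    A-same i∈ = keep₂ (firsts#seconds Z un i∈)
    SA : ∀ x → S s₂ A x ≡ S s₁ A x
    SA x = Σ-cong A (λ i∈ → A-same i∈ x)
    S₃ : ∀ x → S s₃ (flat Z) x ≡ S s₁ A x + S s₂ B x
    S₃ x = begin
      S s₃ (flat Z) x          ≡⟨ S-averaged Z x avg ⟩
      S s₂ (flat Z) x          ≡⟨ S-flat s₂ Z x ⟩
      S s₂ A x + S s₂ B x      ≡⟨ cong (_+ S s₂ B x) (SA x) ⟩
      S s₁ A x + S s₂ B x      ∎
    sums : ∀ x → S s₃ (flat Z) x ≡ S s (flat Z) x
    sums x = begin
      S s₃ (flat Z) x          ≡⟨ S₃ x ⟩
      S s₁ A x + S s₂ B x      ≡⟨ cong₂ _+_ (sum₁ x) (trans (sum₂ x) (Σ-cong B (λ i∈ → keep₁ (λ i∈A → firsts#seconds Z un i∈A i∈) x))) ⟩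
      S s A x + S s B x        ≡⟨ S-flat s Z x ⟨
      S s (flat Z) x           ∎
    lev : Level (f + 3) (flat Z) s₃
    lev l∈ x with flat-split Z l∈
    ... | (i , j) , z∈ , which with avg z∈ x
    ...   | eq , le , ge = subst₂ (λ N T → Near (f + 3) N T _) (sym (length-flat Z)) (sym (S₃ x)) (near which)
      where
      a = length Z
      near-i : Near f a (S s₁ A x) (d s₂ i x)
      near-i = subst₂ (λ N e → Near f N (S s₁ A x) e) (length-map proj₁ Z)
        (sym (A-same (∈-map⁺ proj₁ z∈) x)) (lev₁ (∈-map⁺ proj₁ z∈) x)
      near-j : Near f a (S s₂ B x) (d s₂ j x)
      near-j = subst (λ N → Near f N (S s₂ B x) (d s₂ j x)) (length-map proj₂ Z) (lev₂ (∈-map⁺ proj₂ z∈) x)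
      near : ∀ {l} → l ≡ i ⊎ l ≡ j → Near (f + 3) (a * 2) (S s₁ A x + S s₂ B x) (d s₃ l x)
      near (inj₁ refl) = near-double {f} {a} near-i near-j eq le ge
      near (inj₂ refl) = subst (λ T → Near (f + 3) (a * 2) T (d s₃ j x)) (+-comm (S s₂ B x) _)
        (near-double {f} {a} near-j near-i (trans (+-comm (d s₃ j x) _) (trans eq (+-comm (d s₂ i x) _))) ge le)

  Keeps-trans : ∀ {C s s₁ s₂} → Keeps C s s₁ → Keeps C s₁ s₂ → Keeps C s s₂
  Keeps-trans (k₁ , e₁) (k₂ , e₂) = (λ l∉ x → trans (k₂ l∉ x) (k₁ l∉ x)) , (λ x → trans (e₂ x) (e₁ x))

  level-suc : ∀ {f} p o R → Unique (p ∷ o ∷ R) → f ≤ 6 * suc (length R) →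
              CanLevel f (o ∷ R) → CanLevel (f + 6) (p ∷ o ∷ R)
  level-suc {f} p o R ((p≢o ∷ pR) ∷ oR ∷ un) f≤ level s with level s
  ... | s₁ , (keep₁ , sum₁) , lev₁ = finish (shrink (N * bound) s₁ lev₁ gap₁)
    where
    open Shrink (length R) f
    C = o ∷ R
    p∉C : p ∉ C
    p∉C = λ { (here refl) → p≢o refl ; (there p∈) → All.lookup pR p∈ refl }

    Gap : St → ℕ → Set
    Gap s t = ∀ x → N * d s p x ≤ S s C x + (K + t) × S s C x ≤ N * d s p x + (K + t)

    -- Any bound on the initial gap will do; it starts the countdown `t`.
    gap₁ : Gap s₁ (N * bound)
    gap₁ x = ≤-trans (*-monoʳ-≤ N (d≤bound s₁ p x)) (≤-trans (m≤n+m _ K) (m≤n+m _ (S s₁ C x))) ,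
             ≤-trans (S≤ s₁ C x) (≤-trans (m≤n+m _ K) (m≤n+m _ (N * d s₁ p x)))

    transfer : ∀ {s s₁} → (∀ x → d s₁ p x + d s₁ o x ≡ d s p x + d s o x) →
               (∀ {l} → l ≢ p → l ≢ o → ∀ x → d s₁ l x ≡ d s l x) →
               ∀ x → S s₁ C x + d s₁ p x ≡ S s C x + d s p x
    transfer {s} {s₁} sum₁ same₁ x = begin
      d s₁ o x + S s₁ R x + d s₁ p x    ≡⟨ e (d s₁ o x) (S s₁ R x) (d s₁ p x) ⟩
      d s₁ p x + d s₁ o x + S s₁ R x    ≡⟨ cong₂ _+_ (sum₁ x) R-same ⟩
      d s p x + d s o x + S s R x       ≡⟨ e (d s o x) (S s R x) (d s p x) ⟨
      d s o x + S s R x + d s p x       ∎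
      where
      open ≡-Reasoning
      e : ∀ a b c → a + b + c ≡ c + a + b
      e = solve-∀
      R-same : S s₁ R x ≡ S s R x
      R-same = Σ-cong R (λ l∈ → same₁ (≢-sym (All.lookup pR l∈)) (≢-sym (All.lookup oR l∈)) x)

    shrink : ∀ t s → Level f C s → Gap s t → ∃ λ s′ → Keeps (p ∷ C) s s′ × Level f C s′ × Gap s′ 0
    shrink zero    s lev gap = s , ((λ _ _ → refl) , (λ _ → refl)) , lev , gap
    -- The partner is always `o`: levelling `C` again brings it back near the mean, so a fixed
    -- member will do.
    shrink (suc t) s lev gap with average s p≢o
    ... | s₁ , sum₁ , le , ge , same₁ with level s₁
    ...   | s₂ , (keep₂ , sum₂) , lev₂ with shrink t s₂ lev₂ gap₂
      where
      moved : ∀ x → S s₁ C x + d s₁ p x ≡ S s C x + d s p x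
      moved = transfer sum₁ same₁
      gap₂ : Gap s₂ t
      gap₂ x rewrite sum₂ x | keep₂ p∉C x =
        shrink-upper {S = S s C x} (proj₁ (gap x)) (proj₁ (lev (here refl) x)) (sum₁ x) (le x) (moved x) ,
        shrink-lower {S = S s C x} (proj₂ (gap x)) (proj₂ (lev (here refl) x)) (sum₁ x) (ge x) (moved x)
    ...     | s₃ , keeps₃ , lev₃ , gap₃ = s₃ , Keeps-trans (keep , sums) keeps₃ , lev₃ , gap₃
      where
      keep : ∀ {l} → l ∉ p ∷ C → ∀ x → d s₂ l x ≡ d s l x
      keep l∉ x = trans (keep₂ (l∉ ∘ there) x) (same₁ (l∉ ∘ here) (l∉ ∘ there ∘ here) x)
      sums : ∀ x → S s₂ (p ∷ C) x ≡ S s (p ∷ C) x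
      sums x = trans (cong₂ _+_ (keep₂ p∉C x) (sum₂ x))
        (trans (+-comm (d s₁ p x) _) (trans (transfer sum₁ same₁ x) (+-comm (S s C x) _)))

    finish : (∃ λ s′ → Keeps (p ∷ C) s₁ s′ × Level f C s′ × Gap s′ 0) →
             ∃ λ s′ → Keeps (p ∷ C) s s′ × Level (f + 6) (p ∷ C) s′
    finish (s₂ , keeps₂ , lev₂ , gap₂) = s₂ ,
      Keeps-trans ((λ l∉ → keep₁ (l∉ ∘ there)) , (λ x → cong₂ _+_ (keep₁ p∉C x) (sum₁ x))) keeps₂ , lev
      where
      upper : ∀ x → N * d s₂ p x ≤ S s₂ C x + K
      upper x = subst (λ k → N * d s₂ p x ≤ S s₂ C x + k) (+-identityʳ K) (proj₁ (gap₂ x))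
      lower : ∀ x → S s₂ C x ≤ N * d s₂ p x + K
      lower x = subst (λ k → S s₂ C x ≤ N * d s₂ p x + k) (+-identityʳ K) (proj₂ (gap₂ x))
      lev : Level (f + 6) (p ∷ C) s₂
      lev (here refl) x = near-x (upper x) (lower x)
      lev (there i∈)  x = near-o f≤ (upper x) (lower x) (lev₂ i∈ x)

  Levels : ℕ → Set
  Levels ℓ = ∃ λ f → Cost ℓ f × (∀ C → Unique C → length C ≡ ℓ → CanLevel f C)

  can-double : ∀ {ℓ f} → (∀ C → Unique C → length C ≡ ℓ → CanLevel f C) →
               ∀ C → Unique C → length C ≡ ℓ * 2 → CanLevel (f + 3) C
  can-double {ℓ} lev C un len with pair-up ℓ C len
  ... | Z , eq , refl = level-double Z un
    (lev (firsts Z) (unique-firsts Z un) (trans (length-map proj₁ Z) eq))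
    (lev (seconds Z) (unique-seconds Z un) (trans (length-map proj₂ Z) eq))

  levels-double : ∀ {ℓ} → 1 ≤ ℓ → Levels ℓ → Levels (ℓ * 2)
  levels-double 1≤ℓ (f , c , lev) = f + 3 , cost-double 1≤ℓ c , can-double lev

  levels-suc-double : ∀ {ℓ} → 1 ≤ ℓ → Levels ℓ → Levels (suc (ℓ * 2))
  levels-suc-double {ℓ} 1≤ℓ (f , c , lev) = f + 3 + 6 , cost-suc-double 1≤ℓ c , can
    where
    can : ∀ C → Unique C → length C ≡ suc (ℓ * 2) → CanLevel (f + 3 + 6) C
    can []          un       len = contradiction len λ ()
    can (p ∷ [])    un       len = contradiction (subst (1 ≤_) (m*n≡0⇒m≡0 ℓ 2 (sym (suc-injective len))) 1≤ℓ) λ ()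
    can (p ∷ o ∷ R) un@(_ ∷ un′) len = level-suc p o R un
      (subst (λ k → f + 3 ≤ 6 * k) (sym (suc-injective len)) (linear (cost-double 1≤ℓ c)))
      (can-double lev (o ∷ R) un′ (suc-injective len))

  -- Recursion on the binary digits of `ℓ`, with `n` as fuel: a single tree is level at no cost, and
  -- each further digit costs 3 or 9.
  levels : ∀ n ℓ → ℓ < n → 1 ≤ ℓ → Levels ℓ
  levels (suc n) ℓ ℓ<n 1≤ℓ with half ℓ
  levels (suc n) ℓ ℓ<n ()  | zero , inj₁ refl
  levels (suc n) ℓ ℓ<n 1≤ℓ | zero , inj₂ refl =
    0 , cost z≤n (s≤s z≤n) , λ { (i ∷ []) un len → level-singleton i }
  levels (suc n) ℓ ℓ<n 1≤ℓ | suc a , inj₁ refl = levels-double (s≤s z≤n)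
    (levels n (suc a) (≤-pred (≤-trans (s≤s (s≤s (s≤s (m≤m*n a 2)))) ℓ<n)) (s≤s z≤n))
  levels (suc n) ℓ ℓ<n 1≤ℓ | suc a , inj₂ refl = levels-suc-double (s≤s z≤n)
    (levels n (suc a) (≤-pred (≤-trans (s≤s (s≤s (s≤s (≤-trans (m≤m*n a 2) (n≤1+n _))))) ℓ<n)) (s≤s z≤n))

-- Sizes of connected and acyclic edge sets

module Trees {A : Set} (_≟_ : DecidableEquality A) where

  open Points _≟_
  open TwoTrees _≟_ using (Unique-↭; tail≢; untail)
  open Discharge _≟_ using (∈⇒↭)
  open DecMembership _≟_ using (_∈?_)

  module _ {I : Set} where

    -- Edges are names with endpoints given by `τ`, so contracting an edge alters `τ` and leaves the
    -- other names alone.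
    Link : (I → A × A) → (I → Set) → A → A → Set
    Link τ P u w = ∃ λ f → P f × (proj₁ (τ f) ≡ u × proj₂ (τ f) ≡ w ⊎ proj₂ (τ f) ≡ u × proj₁ (τ f) ≡ w)

    Walk : (I → A × A) → (I → Set) → A → A → Set
    Walk τ P = Star (Link τ P)

    Link-sym : ∀ {τ P u w} → Link τ P u w → Link τ P w u
    Link-sym (f , pf , inj₁ (p , q)) = f , pf , inj₂ (q , p)
    Link-sym (f , pf , inj₂ (p , q)) = f , pf , inj₁ (q , p)

    glued : A → A → (I → A × A) → I → A × A
    glued a b τ f = glue a b (proj₁ (τ f)) , glue a b (proj₂ (τ f))

    -- Contracting the edge `f` keeps everything connected and removes one edge and at most one
    -- vertex of `V`.
    connected-size : ∀ F (τ : I → A × A) V → Unique V →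
                     (∀ {u w} → u ∈ V → w ∈ V → Walk τ (_∈ F) u w) → length V ≤ suc (length F)
    connected-size [] τ []          un con = z≤n
    connected-size [] τ (v ∷ [])    un con = s≤s z≤n
    connected-size [] τ (v ∷ u ∷ V) un con with con (here refl) (there (here refl))
    ... | ε                 = contradiction refl (tail≢ un (here refl))
    ... | (f , () , _) ◅ _
    connected-size (f ∷ F) τ V un con = by (b ∈? V)
      where
      a = proj₁ (τ f)
      b = proj₂ (τ f)
      glue-link : ∀ {u w} → Link τ (_∈ f ∷ F) u w → Walk (glued a b τ) (_∈ F) (glue a b u) (glue a b w)
      glue-link (_ , here refl , inj₁ (refl , refl)) = subst₂ (Walk _ _) (sym (glue-a a b)) (sym (glue-b a b)) ε
      glue-link (_ , here refl , inj₂ (refl , refl)) = subst₂ (Walk _ _) (sym (glue-b a b)) (sym (glue-a a b)) ε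
      glue-link (g , there g∈ , inj₁ (refl , refl))  = return (g , g∈ , inj₁ (refl , refl))
      glue-link (g , there g∈ , inj₂ (refl , refl))  = return (g , g∈ , inj₂ (refl , refl))
      rest : ∀ V′ → Unique V′ → (∀ {u} → u ∈ V′ → u ∈ V × u ≢ b) → length V′ ≤ suc (length F)
      rest V′ un′ sub = connected-size F (glued a b τ) V′ un′ λ u∈ w∈ →
        subst₂ (Walk _ _) (glue-≢ (proj₂ (sub u∈))) (glue-≢ (proj₂ (sub w∈)))
          (kleisliStar (glue a b) glue-link (con (proj₁ (sub u∈)) (proj₁ (sub w∈))))
      by : Dec (b ∈ V) → length V ≤ suc (suc (length F))
      by (no b∉) = ≤-trans (rest V un λ u∈ → u∈ , λ { refl → b∉ u∈ }) (n≤1+n _)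
      by (yes b∈) with ∈⇒↭ b∈
      ... | V′ , p = subst (_≤ suc (suc (length F))) (sym (↭-length p)) (s≤s (rest V′ (AllPairs.tail un′)
              λ u∈ → ∈-resp-↭ (↭-sym p) (there u∈) , tail≢ un′ u∈))
        where
        un′ : Unique (b ∷ V′)
        un′ = Unique-↭ p un

    -- `f` is no loop, so contracting it removes exactly one vertex; a cycle in the contraction
    -- lifts back by passing through `f` where needed.
    acyclic-size : ∀ F (τ : I → A × A) V → Unique F → Unique V → ∃ (_∈ V) →
                   (∀ {f} → f ∈ F → proj₁ (τ f) ∈ V × proj₂ (τ f) ∈ V) →
                   (∀ {f} → f ∈ F → ¬ Walk τ (λ g → g ∈ F × g ≢ f) (proj₁ (τ f)) (proj₂ (τ f))) →
                   suc (length F) ≤ length V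
    acyclic-size [] τ (v ∷ V) unF unV ne ends acyc = s≤s z≤n
    acyclic-size (f ∷ F) τ V unF unV ne ends acyc with ∈⇒↭ (proj₂ (ends (here refl)))
    ... | V′ , p = subst (suc (suc (length F)) ≤_) (sym (↭-length p))
        (s≤s (acyclic-size F (glued a b τ) V′ (AllPairs.tail unF) (AllPairs.tail unV′) (a , a∈V′)
          (λ g∈ → glue∈ (proj₁ (ends (there g∈))) , glue∈ (proj₂ (ends (there g∈)))) acyc′))
      where
      a = proj₁ (τ f)
      b = proj₂ (τ f)
      unV′ : Unique (b ∷ V′)
      unV′ = Unique-↭ p unV
      a≢b : a ≢ b
      a≢b a≡b = acyc (here refl) (subst (Walk _ _ a) a≡b ε)
      a∈V′ : a ∈ V′
      a∈V′ = untail (∈-resp-↭ p (proj₁ (ends (here refl)))) a≢b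
      glue∈ : ∀ {u} → u ∈ V → glue a b u ∈ V′
      glue∈ {u} u∈ with u ≟ b
      ... | yes _  = a∈V′
      ... | no u≢b = untail (∈-resp-↭ p u∈) u≢b
      acyc′ : ∀ {g} → g ∈ F → ¬ Walk (glued a b τ) (λ h → h ∈ F × h ≢ g) (glue a b (proj₁ (τ g))) (glue a b (proj₂ (τ g)))
      acyc′ {g} g∈ walk = acyc (there g∈)
        (unglue (proj₁ (τ g)) ◅◅ kleisliStar id lift walk ◅◅ reverse (λ {u w} → Link-sym) (unglue (proj₂ (τ g))))
        where
        Rest : I → Set
        Rest h = h ∈ f ∷ F × h ≢ g
        unglue : ∀ u → Walk τ Rest u (glue a b u)
        unglue u with u ≟ b
        ... | yes refl = return (f , (here refl , ≢-sym (tail≢′ g∈)) , inj₂ (refl , refl))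
          where
          tail≢′ : ∀ {h} → h ∈ F → h ≢ f
          tail≢′ h∈ refl = All.lookup (AllPairs.head unF) h∈ refl
        ... | no _ = ε
        lift : ∀ {u w} → Link (glued a b τ) (λ h → h ∈ F × h ≢ g) u w → Walk τ Rest u w
        lift (h , (h∈ , h≢) , inj₁ (refl , refl)) =
          reverse (λ {u w} → Link-sym) (unglue (proj₁ (τ h))) ◅◅ return (h , (there h∈ , h≢) , inj₁ (refl , refl)) ◅◅ unglue (proj₂ (τ h))
        lift (h , (h∈ , h≢) , inj₂ (refl , refl)) =
          reverse (λ {u w} → Link-sym) (unglue (proj₂ (τ h))) ◅◅ return (h , (there h∈ , h≢) , inj₂ (refl , refl)) ◅◅ unglue (proj₁ (τ h))

-- Factorizations as edge colourings, and the exchange between two trees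

module EdgeSets (G : Graph) where

  V : Set
  V = Fin (n G)

  E : Set
  E = Fin (m G)

  open Trees (_≟_ {n G})
  open TwoTrees (_≟_ {n G})
  open Points (_≟_ {n G})
  open Discharge (_≟_ {n G})

  In : EdgeSet G → E → Set
  In S e = S e ≡ true

  Reach⇒Walk : ∀ {S u w} → Reach G S u w → Walk (ends G) (In S) u w
  Reach⇒Walk here             = ε
  Reach⇒Walk (stepF e s p r)  = (e , s , inj₁ (p , refl)) ◅ Reach⇒Walk r
  Reach⇒Walk (stepB e s p r)  = (e , s , inj₂ (p , refl)) ◅ Reach⇒Walk r

  Walk⇒Reach : ∀ {S u w} → Walk (ends G) (In S) u w → Reach G S u w
  Walk⇒Reach ε                             = here
  Walk⇒Reach ((e , s , inj₁ (p , refl)) ◅ r) = stepF e s p (Walk⇒Reach r)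
  Walk⇒Reach ((e , s , inj₂ (p , refl)) ◅ r) = stepB e s p (Walk⇒Reach r)

  Walk-mono : ∀ {P Q : E → Set} {u w} → (∀ {e} → P e → Q e) → Walk (ends G) P u w → Walk (ends G) Q u w
  Walk-mono sub = kleisliStar id λ (e , pe , h) → return (e , sub pe , h)

  without-In : ∀ S e {f} → In (without G S e) f → In S f × f ≢ e
  without-In S e {f} s with e ≟ f
  ... | no e≢f = s , ≢-sym e≢f

  In-without : ∀ S e {f} → In S f → f ≢ e → In (without G S e) f
  In-without S e {f} s f≢e with e ≟ f
  ... | yes e≡f = contradiction (sym e≡f) f≢e
  ... | no  _   = s

  edges : EdgeSet G → List E
  edges S = filter (λ e → S e Boolₚ.≟ true) (allFin (m G))

  ∈-edges : ∀ S {e} → In S e → e ∈ edges S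
  ∈-edges S s = ∈-filter⁺ (λ e → S e Boolₚ.≟ true) (∈-allFin _) s

  edges-In : ∀ S {e} → e ∈ edges S → In S e
  edges-In S e∈ = proj₂ (∈-filter⁻ (λ e → S e Boolₚ.≟ true) {xs = allFin (m G)} e∈)

  edges-unique : ∀ S → Unique (edges S)
  edges-unique S = filter⁺ (λ e → S e Boolₚ.≟ true) (allFin⁺ (m G))

  weight : EdgeSet G → (E → ℕ) → ℕ
  weight S w = Σ (λ e → if S e then w e else 0) (allFin (m G))

  card : EdgeSet G → ℕ
  card S = weight S (λ _ → 1)

  length-edges : ∀ S → length (edges S) ≡ card S
  length-edges S = go (allFin (m G))
    where
    go : ∀ xs → length (filter (λ e → S e Boolₚ.≟ true) xs) ≡ Σ (λ e → if S e then 1 else 0) xs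
    go [] = refl
    go (x ∷ xs) with S x
    ... | true  = cong suc (go xs)
    ... | false = go xs

  length-vertices : length (allFin (n G)) ≡ n G
  length-vertices = length-tabulate {n = n G} id

  acyclic⇒card : ∀ {S} → V → Acyclic G S → suc (card S) ≤ n G
  acyclic⇒card {S} v acyc = subst₂ (λ a b → suc a ≤ b) (length-edges S) length-vertices
    (acyclic-size (edges S) (ends G) (allFin (n G)) (edges-unique S) (allFin⁺ (n G)) (v , ∈-allFin v)
      (λ _ → ∈-allFin _ , ∈-allFin _)
      λ {e} e∈ walk → acyc e (edges-In S e∈)
        (Walk⇒Reach (Walk-mono (λ (f∈ , f≢e) → In-without S e (edges-In S f∈) f≢e) walk)))

  connected⇒card : ∀ {S} → Connected G S → n G ≤ suc (card S)
  connected⇒card {S} con = subst₂ (λ a b → a ≤ suc b) length-vertices (length-edges S)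
    (connected-size (edges S) (ends G) (allFin (n G)) (allFin⁺ (n G))
      λ {u} {w} _ _ → Walk-mono (∈-edges S) (Reach⇒Walk (con u w)))

  -- If an edge e lay on a cycle, the other edges would connect the graph
  -- although there are at most n - 2 of them.
  connected⇒acyclic : ∀ {S} → Connected G S → suc (card S) ≤ n G → Acyclic G S
  connected⇒acyclic {S} con le e e∈S cycle with ∈⇒↭′ (∈-edges S e∈S)
    where
    ∈⇒↭′ : ∀ {x : E} {xs} → x ∈ xs → ∃ λ ys → xs ↭ x ∷ ys
    ∈⇒↭′ = Discharge.∈⇒↭ _≟_
  ... | F , p = 1+n≰n (begin-strict
      length F             <⟨ n<1+n _ ⟩
      suc (length F)       ≡⟨ ↭-length p ⟨
      length (edges S)     ≡⟨ length-edges S ⟩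
      card S               ≤⟨ ≤-pred (≤-trans le (≤-trans (≤-reflexive (sym length-vertices)) spans)) ⟩
      length F             ∎)
    where
    open ≤-Reasoning
    rest : ∀ {f} → In S f → f ≢ e → f ∈ F
    rest s f≢e with ∈-resp-↭ p (∈-edges S s)
    ... | here f≡e = contradiction f≡e f≢e
    ... | there f∈ = f∈
    bypass : Walk (ends G) (_∈ F) (proj₁ (ends G e)) (proj₂ (ends G e))
    bypass = Walk-mono (λ s → let s′ , f≢e = without-In S e s in rest s′ f≢e) (Reach⇒Walk cycle)
    link : ∀ {u w} → Link (ends G) (In S) u w → Walk (ends G) (_∈ F) u w
    link (f , s , h) with f ≟ e
    link (f , s , inj₁ (refl , refl)) | yes refl = bypass
    link (f , s , inj₂ (refl , refl)) | yes refl = reverse (λ {u w} → Link-sym) bypass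
    link (f , s , h) | no f≢e = return (f , rest s f≢e , h)
    spans : length (allFin (n G)) ≤ suc (length F)
    spans = connected-size F (ends G) (allFin (n G)) (allFin⁺ (n G))
      λ {u} {w} _ _ → kleisliStar id link (Reach⇒Walk (con u w))

  SpanningTree-resp : ∀ {S S′} → (∀ e → S e ≡ S′ e) → SpanningTree G S → SpanningTree G S′
  SpanningTree-resp {S} {S′} eq (con , acyc) =
    (λ u w → Walk⇒Reach (Walk-mono (λ {e} s → trans (sym (eq e)) s) (Reach⇒Walk (con u w)))) ,
    λ e s cycle → acyc e (trans (eq e) s) (Walk⇒Reach (Walk-mono
      (λ {f} s′ → let s″ , f≢e = without-In S′ e s′ in In-without S e (trans (eq f) s″) f≢e) (Reach⇒Walk cycle)))

  incidence : V → E → ℕ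
  incidence v e = on (proj₁ (ends G e)) v 1 + on (proj₂ (ends G e)) v 1

  module _ {k : ℕ} where

    -- Factorizations are given by index maps `χ`, so that disjointness and covering hold by
    -- construction.
    class : (E → Fin k) → Fin k → EdgeSet G
    class χ i e = ⌊ χ e ≟ i ⌋

    class-yes : ∀ χ {i e} → χ e ≡ i → In (class χ i) e
    class-yes χ {i} {e} eq with χ e ≟ i
    ... | yes _ = refl
    ... | no ne = contradiction eq ne

    class-no : ∀ χ {i e} → χ e ≢ i → class χ i e ≡ false
    class-no χ {i} {e} ne with χ e ≟ i
    ... | yes eq = contradiction eq ne
    ... | no _   = refl

    class-≡ : ∀ χ {i e} → In (class χ i) e → χ e ≡ i
    class-≡ χ {i} {e} s with χ e ≟ i
    ... | yes eq = eq

    -- The edge count stands in for acyclicity, as it is easily followed through an exchange;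
    -- `connected⇒acyclic` gives acyclicity back.
    AllTrees : (E → Fin k) → Set
    AllTrees χ = ∀ i → Connected G (class χ i) × suc (card (class χ i)) ≤ n G

  edge : (E → Bool) → E → Edge
  edge b e = b e , ends G e

  -- The colours in the list define a function on edges because `F` has no repetition; outside `F`
  -- its values are those of `b₀`.
  recolouring : ∀ {b₀ M} F → Unique F → Recol M (map (edge b₀) F) → ∃ λ b → M ≡ map (edge b) F
  recolouring {b₀} []      un        []      = b₀ , refl
  recolouring      (f ∷ F) (ne ∷ un) (c ∷ r) with recolouring F un r
  ... | b , refl = b′ , cong₂ _∷_ (cong (_, ends G f) (sym b′-f)) (same F ne)
    where
    b′ : E → Bool
    b′ e = if ⌊ e ≟ f ⌋ then c else b e
    b′-f : b′ f ≡ c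
    b′-f with f ≟ f
    ... | yes _  = refl
    ... | no f≢f = contradiction refl f≢f
    same : ∀ F → All (f ≢_) F → map (edge b) F ≡ map (edge b′) F
    same []      []           = refl
    same (g ∷ F) (f≢g ∷ f≢F) with g ≟ f
    ... | yes refl = contradiction refl f≢g
    ... | no _     = cong (_ ∷_) (same F f≢F)

  Adj-edge : ∀ {b c e u w} F → e ∈ F → b e ≡ c →
             proj₁ (ends G e) ≡ u × proj₂ (ends G e) ≡ w ⊎ proj₂ (ends G e) ≡ u × proj₁ (ends G e) ≡ w →
             Adj c (map (edge b) F) u w
  Adj-edge (f ∷ F) (here refl) refl (inj₁ (refl , refl)) = fwd
  Adj-edge (f ∷ F) (here refl) refl (inj₂ (refl , refl)) = bwd
  Adj-edge (f ∷ F) (there e∈)  eq   h                    = next (Adj-edge F e∈ eq h)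

  edge-Adj : ∀ {b c u w} F → Adj c (map (edge b) F) u w → Link (ends G) (λ e → e ∈ F × b e ≡ c) u w
  edge-Adj (f ∷ F) fwd      = f , (here refl , refl) , inj₁ (refl , refl)
  edge-Adj (f ∷ F) bwd      = f , (here refl , refl) , inj₂ (refl , refl)
  edge-Adj (f ∷ F) (next a) = let e , (e∈ , eq) , h = edge-Adj F a in e , (there e∈ , eq) , h

  cdeg-edges : ∀ {b c v} q S → (∀ e → In q e → S e ≡ true × b e ≡ c ⊎ S e ≡ false × b e ≡ not c) →
               (∀ e → q e ≡ false → S e ≡ false) →
               cdeg c (map (edge b) (edges q)) v ≡ weight S (incidence v)
  cdeg-edges {b} {c} {v} q S inside outside = go (allFin (m G))
    where
    on-zero : ∀ x → on x v 0 ≡ 0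
    on-zero x with x ≟ v
    ... | yes _ = refl
    ... | no  _ = refl
    col-not : ∀ c → col c (not c) ≡ 0
    col-not true  = refl
    col-not false = refl
    go : ∀ xs → cdeg c (map (edge b) (filter (λ e → q e Boolₚ.≟ true) xs)) v ≡
                Σ (λ e → if S e then incidence v e else 0) xs
    go [] = refl
    go (x ∷ xs) with q x in eq
    ... | false rewrite outside x eq = go xs
    ... | true with inside x eq
    ...   | inj₁ (s , t) rewrite s | t | col-refl c = cong (incidence v x +_) (go xs)
    ...   | inj₂ (s , t) rewrite s | t | col-not c
                               | on-zero (proj₁ (ends G x)) | on-zero (proj₂ (ends G x)) = go xs

  dichotomy : ∀ b → b ≡ true ⊎ b ≡ false
  dichotomy true  = inj₁ refl
  dichotomy false = inj₂ refl

  module Average {k : ℕ} (χ : E → Fin k) (trees : AllTrees χ) {i j : Fin k} (i≢j : i ≢ j) where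

    colour : Bool → Fin k
    colour c = if c then i else j

    colour-inj : ∀ {c d} → colour c ≡ colour d → c ≡ d
    colour-inj {true}  {true}  eq = refl
    colour-inj {true}  {false} eq = contradiction eq i≢j
    colour-inj {false} {true}  eq = contradiction (sym eq) i≢j
    colour-inj {false} {false} eq = refl

    both : (E → Fin k) → EdgeSet G
    both ψ e = class ψ i e ∨ class ψ j e

    both-yes : ∀ ψ c {e} → ψ e ≡ colour c → In (both ψ) e
    both-yes ψ true  {e} eq rewrite class-yes ψ {i} {e} eq = refl
    both-yes ψ false {e} eq rewrite class-yes ψ {j} {e} eq = Boolₚ.∨-zeroʳ (class ψ i e)

    both-no : ∀ ψ {e} → (∀ c → ψ e ≢ colour c) → both ψ e ≡ false
    both-no ψ {e} ne rewrite class-no ψ {i} {e} (ne true) | class-no ψ {j} {e} (ne false) = refl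

    both-split : ∀ ψ {e} → In (both ψ) e → ∃ λ c → ψ e ≡ colour c
    both-split ψ {e} q with ψ e ≟ i | ψ e ≟ j
    ... | yes eq | _      = true , eq
    ... | no _   | yes eq = false , eq

    weight-both : ∀ ψ w → weight (class ψ i) w + weight (class ψ j) w ≡ weight (both ψ) w
    weight-both ψ w = trans (sym (Σ-+ _ _ (allFin (m G)))) (Σ-cong (allFin (m G)) λ {e} _ → pointwise e)
      where
      pointwise : ∀ e → (if class ψ i e then w e else 0) + (if class ψ j e then w e else 0) ≡
                        (if both ψ e then w e else 0)
      pointwise e with ψ e ≟ i | ψ e ≟ j
      ... | yes p | yes q = contradiction (trans (sym p) q) i≢j
      ... | yes _ | no  _ = +-identityʳ (w e)
      ... | no  _ | yes _ = refl
      ... | no  _ | no  _ = refl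

    F : List E
    F = edges (both χ)

    L : List Edge
    L = map (edge (class χ i)) F

    class-i : ∀ c {e} → χ e ≡ colour c → class χ i e ≡ c
    class-i true  eq = class-yes χ eq
    class-i false eq = class-no χ (λ eq′ → i≢j (trans (sym eq′) eq))

    connected-colour : ∀ ψ → (∀ l → Connected G (class ψ l)) → ∀ c {u w} →
                       Walk (ends G) (In (class ψ (colour c))) u w
    connected-colour ψ con c {u} {w} = Reach⇒Walk (con (colour c) u w)

    spanning : Spanning (allFin (n G)) L
    spanning c {u} {w} _ _ = kleisliStar id
      (λ (e , s , h) → let eq = class-≡ χ {colour c} {e} s in
        return (Adj-edge F (∈-edges (both χ) (both-yes χ c eq)) (class-i c eq) h))
      (connected-colour χ (proj₁ ∘ trees) c)

    sizes : 2 + card (both χ) ≤ 2 * n G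
    sizes = begin
      2 + card (both χ)                                 ≡⟨ cong (2 +_) (weight-both χ (λ _ → 1)) ⟨
      2 + (card (class χ i) + card (class χ j))         ≡⟨ e (card (class χ i)) (card (class χ j)) ⟩
      suc (card (class χ i)) + suc (card (class χ j))   ≤⟨ +-mono-≤ (proj₂ (trees i)) (proj₂ (trees j)) ⟩
      n G + n G                                         ≡⟨ cong (n G +_) (+-identityʳ (n G)) ⟨
      2 * n G                                           ∎
      where
      open ≤-Reasoning
      e : ∀ a b → 2 + (a + b) ≡ suc a + suc b
      e = solve-∀

    shape-L : Shape (allFin (n G)) L
    shape-L = shape (allFin⁺ (n G)) (inside F)
      (subst₂ (λ a b → 2 + a ≤ 2 * b) (sym (trans (length-map _ F) (length-edges (both χ)))) (sym length-vertices) sizes)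
      where
      inside : ∀ F → AllEnds (_∈ allFin (n G)) (map (edge (class χ i)) F)
      inside []      = []
      inside (f ∷ F) = (∈-allFin _ , ∈-allFin _) ∷ inside F

    -- `total′` and `other` range over all weights: incidences give the degrees, the constant 1
    -- gives the edge counts.
    record Averaging : Set where
      field
        χ′     : E → Fin k
        trees′ : AllTrees χ′
        total′ : ∀ w → weight (class χ′ i) w + weight (class χ′ j) w ≡ weight (class χ i) w + weight (class χ j) w
        other  : ∀ {l} → l ≢ i → l ≢ j → ∀ w → weight (class χ′ l) w ≡ weight (class χ l) w
        close  : ∀ c v → weight (class χ′ (colour c)) (incidence v) ≤ 6 + weight (class χ′ (colour (not c))) (incidence v)

    averaging : Averaging
    averaging with solvable (allFin (n G)) L shape-L spanning
    ... | M , r , conM , balM with recolouring F (edges-unique (both χ)) r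
    ...   | b , refl = record
      { χ′ = χ′ ; trees′ = trees′ ; total′ = total′ ; other = other ; close = close }
      where
      χ′ : E → Fin k
      χ′ e = if both χ e then colour (b e) else χ e

      χ′-in : ∀ {e} → In (both χ) e → χ′ e ≡ colour (b e)
      χ′-in q rewrite q = refl

      χ′-out : ∀ {e} → both χ e ≡ false → χ′ e ≡ χ e
      χ′-out q rewrite q = refl

      out-≢ : ∀ {e} → both χ e ≡ false → ∀ c → χ e ≢ colour c
      out-≢ q c eq = contradiction (trans (sym (both-yes χ c eq)) q) λ ()

      both-same : ∀ e → both χ′ e ≡ both χ e
      both-same e with dichotomy (both χ e)
      ... | inj₁ q = trans (both-yes χ′ (b e) (χ′-in q)) (sym q)
      ... | inj₂ q = trans (both-no χ′ (λ c eq → out-≢ q c (trans (sym (χ′-out q)) eq))) (sym q)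

      total′ : ∀ w → weight (class χ′ i) w + weight (class χ′ j) w ≡ weight (class χ i) w + weight (class χ j) w
      total′ w = trans (weight-both χ′ w) (trans
        (Σ-cong (allFin (m G)) (λ {e} _ → cong (λ t → if t then w e else 0) (both-same e)))
        (sym (weight-both χ w)))

      class-other : ∀ {l} → l ≢ i → l ≢ j → ∀ e → class χ′ l e ≡ class χ l e
      class-other {l} l≢i l≢j e with dichotomy (both χ e)
      ... | inj₂ q = cong (λ t → ⌊ t ≟ l ⌋) (χ′-out q)
      ... | inj₁ q with both-split χ q
      ...   | c , eq = trans (class-no χ′ (λ eq′ → colour≢ (b e) (trans (sym (χ′-in q)) eq′)))
                             (sym (class-no χ (λ eq′ → colour≢ c (trans (sym eq) eq′))))
        where
        colour≢ : ∀ c → colour c ≢ l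
        colour≢ true  = ≢-sym l≢i
        colour≢ false = ≢-sym l≢j

      other : ∀ {l} → l ≢ i → l ≢ j → ∀ w → weight (class χ′ l) w ≡ weight (class χ l) w
      other l≢i l≢j w = Σ-cong (allFin (m G)) λ {e} _ → cong (λ t → if t then w e else 0) (class-other l≢i l≢j e)

      cdeg-class : ∀ c v → cdeg c (map (edge b) F) v ≡ weight (class χ′ (colour c)) (incidence v)
      cdeg-class c v = cdeg-edges (both χ) (class χ′ (colour c)) inside outside
        where
        inside : ∀ e → In (both χ) e → In (class χ′ (colour c)) e × b e ≡ c ⊎ class χ′ (colour c) e ≡ false × b e ≡ not c
        inside e q with b e Boolₚ.≟ c
        ... | yes eq = inj₁ (class-yes χ′ (trans (χ′-in q) (cong colour eq)) , eq)
        ... | no ne  = inj₂ (class-no χ′ (λ eq → ne (colour-inj (trans (sym (χ′-in q)) eq))) , ≢⇒≡not (≢-sym ne))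
        outside : ∀ e → both χ e ≡ false → class χ′ (colour c) e ≡ false
        outside e q = class-no χ′ (λ eq → out-≢ q c (trans (sym (χ′-out q)) eq))

      close : ∀ c v → weight (class χ′ (colour c)) (incidence v) ≤ 6 + weight (class χ′ (colour (not c))) (incidence v)
      close c v = subst₂ (λ x y → x ≤ 6 + y) (cdeg-class c v) (cdeg-class (not c) v) (balM c (∈-allFin v))

      con-colour : ∀ c → Connected G (class χ′ (colour c))
      con-colour c u w = Walk⇒Reach (kleisliStar id link (conM c (∈-allFin u) (∈-allFin w)))
        where
        link : ∀ {u w} → Adj c (map (edge b) F) u w → Walk (ends G) (In (class χ′ (colour c))) u w
        link a with edge-Adj F a
        ... | e , (e∈ , refl) , h = return (e , class-yes χ′ (χ′-in (edges-In (both χ) e∈)) , h)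

      -- The other class is connected and so has at least n - 1 edges, while both together have at
      -- most 2(n - 1).
      card-colour : ∀ c → suc (card (class χ′ (colour c))) ≤ n G
      card-colour c = +-cancelʳ-≤ (n G) _ _ (begin
        suc (card (class χ′ (colour c))) + n G                                      ≤⟨ +-monoʳ-≤ (suc (card (class χ′ (colour c)))) (connected⇒card (con-colour (not c))) ⟩
        suc (card (class χ′ (colour c))) + suc (card (class χ′ (colour (not c))))   ≡⟨ cards c ⟩
        suc (card (class χ i)) + suc (card (class χ j))                             ≤⟨ +-mono-≤ (proj₂ (trees i)) (proj₂ (trees j)) ⟩
        n G + n G                                                                   ∎)
        where
        open ≤-Reasoning
        suc-suc : ∀ {a b c d} → a + b ≡ c + d → suc a + suc b ≡ suc c + suc d
        suc-suc {a} {b} {c} {d} eq = trans (cong suc (+-suc a b)) (trans (cong (suc ∘ suc) eq) (cong suc (sym (+-suc c d))))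
        cards : ∀ c → suc (card (class χ′ (colour c))) + suc (card (class χ′ (colour (not c)))) ≡ suc (card (class χ i)) + suc (card (class χ j))
        cards true  = suc-suc {card (class χ′ i)} (total′ (λ _ → 1))
        cards false = suc-suc {card (class χ′ j)} (trans (+-comm (card (class χ′ j)) _) (total′ (λ _ → 1)))

      trees′ : AllTrees χ′
      trees′ l with l ≟ i | l ≟ j
      ... | yes refl | _        = con-colour true , card-colour true
      ... | no _     | yes refl = con-colour false , card-colour false
      ... | no l≢i   | no l≢j   =
        (λ u w → Walk⇒Reach (Walk-mono (λ {e} s → trans (class-other l≢i l≢j e) s) (Reach⇒Walk (proj₁ (trees l) u w)))) ,
        subst (λ a → suc a ≤ n G) (sym (other l≢i l≢j (λ _ → 1))) (proj₂ (trees l))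

-- From levelled trees to the theorem

∣-∣≤ : ∀ {a b t} → a ≤ b + t → b ≤ a + t → ∣ a - b ∣ ≤ t
∣-∣≤ {a} {b} {t} a≤ b≤ with ≤-total a b
... | inj₁ le = subst (_≤ t) (sym (m≤n⇒∣m-n∣≡n∸m le)) (m≤n+o⇒m∸n≤o b a b≤)
... | inj₂ le = subst (_≤ t) (sym (trans (∣-∣-comm a b) (m≤n⇒∣m-n∣≡n∸m le))) (m≤n+o⇒m∸n≤o a b a≤)

near⇒WithinBound : ∀ {f k D d} → 2 ^ f ≤ k ^ 11 → Near f k D d → WithinBound k d D
near⇒WithinBound {f} {k} {D} {d} 2^f≤ (u , l) = begin
  2 ^ ∣ k * d - D ∣     ≤⟨ ^-monoʳ-≤ 2 (∣-∣≤ u l) ⟩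
  2 ^ (k * f)           ≡⟨ cong (2 ^_) (*-comm k f) ⟩
  2 ^ (f * k)           ≡⟨ ^-*-assoc 2 f k ⟨
  (2 ^ f) ^ k           ≤⟨ ^-monoˡ-≤ k 2^f≤ ⟩
  (k ^ 11) ^ k          ≡⟨ ^-*-assoc k 11 k ⟩
  k ^ (11 * k)          ∎
  where open ≤-Reasoning

inhabited? : ∀ k → Fin k ⊎ ¬ Fin k
inhabited? zero    = inj₂ λ ()
inhabited? (suc k) = inj₁ Fin.zero

module Factorization (k : ℕ) (k≥1 : k ≥ 1) (G : Graph) (T : Fin k → EdgeSet G)
                     (fact : IsFactorization k G T) (v₀ : Fin (n G)) where

  open EdgeSets G
  open Points (_≟_ {n G})

  trees-T : ∀ i → SpanningTree G (T i)
  trees-T = proj₁ fact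

  χ₀ : E → Fin k
  χ₀ e = proj₁ (proj₂ (proj₂ fact) e)

  χ₀-T : ∀ e → In (T (χ₀ e)) e
  χ₀-T e = proj₂ (proj₂ (proj₂ fact) e)

  T≡class : ∀ i e → T i e ≡ class χ₀ i e
  T≡class i e with χ₀ e ≟ i | dichotomy (T i e)
  ... | yes refl | _      = χ₀-T e
  ... | no ne    | inj₁ t = contradiction (χ₀-T e) (λ t′ → proj₁ (proj₂ fact) (χ₀ e) i e ne t′ t)
  ... | no _     | inj₂ t = t

  -- `deg` counts a loop once and `incidence` counts it twice; they agree because every edge lies in
  -- a tree and no tree has a loop.
  loopless : ∀ e → proj₁ (ends G e) ≢ proj₂ (ends G e)
  loopless e eq = proj₂ (trees-T (χ₀ e)) e (χ₀-T e) (subst (Reach G _ _) eq here)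

  State : Set
  State = ∃ λ (χ : E → Fin k) → AllTrees χ

  s₀ : State
  s₀ = χ₀ , λ i → let con , acyc = SpanningTree-resp (T≡class i) (trees-T i) in con , acyclic⇒card v₀ acyc

  d : State → Fin k → V → ℕ
  d (χ , _) i v = weight (class χ i) (incidence v)

  on≤1 : ∀ x v → on x v 1 ≤ 1
  on≤1 x v with x ≟ v
  ... | yes _ = ≤-refl
  ... | no  _ = z≤n

  d-bounded : ∀ s i v → d s i v ≤ 2 * length (allFin (m G))
  d-bounded (χ , _) i v = ≤-trans (Σ-mono (allFin (m G)) (All.tabulate λ {e} _ → bounded e))
    (≤-reflexive (Σ-const 2 (allFin (m G))))
    where
    bounded : ∀ e → (if class χ i e then incidence v e else 0) ≤ 2
    bounded e with class χ i e
    ... | true  = +-mono-≤ (on≤1 (proj₁ (ends G e)) v) (on≤1 (proj₂ (ends G e)) v)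
    ... | false = z≤n

  average : ∀ (s : State) {i j} → i ≢ j → ∃ λ s′ →
    (∀ v → d s′ i v + d s′ j v ≡ d s i v + d s j v) ×
    (∀ v → d s′ i v ≤ 6 + d s′ j v) × (∀ v → d s′ j v ≤ 6 + d s′ i v) ×
    (∀ {l} → l ≢ i → l ≢ j → ∀ v → d s′ l v ≡ d s l v)
  average (χ , trees) i≢j = (χ′ , trees′) ,
    (λ v → total′ (incidence v)) , close true , close false , λ l≢i l≢j v → other l≢i l≢j (incidence v)
    where
    open Average χ trees i≢j
    open Averaging averaging

  open Levelling d (2 * length (allFin (m G))) d-bounded average

  -- Every edge has exactly one index, so the mean over the `k` trees is the degree in `G` divided
  -- by `k`.
  S-total : ∀ s v → S s (allFin k) v ≡ Σ (incidence v) (allFin (m G))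
  S-total (χ , _) v = trans (Σ-swap (λ i e → if class χ i e then incidence v e else 0) (allFin k) (allFin (m G)))
    (Σ-cong (allFin (m G)) λ {e} _ → trans (Σ-cong (allFin k) (λ {i} _ → if-on e i))
      (Points.Σ-on _≟_ (incidence v e) (allFin⁺ k) (∈-allFin (χ e))))
    where
    if-on : ∀ e i → (if class χ i e then incidence v e else 0) ≡ Points.on _≟_ (χ e) i (incidence v e)
    if-on e i with χ e ≟ i
    ... | yes _ = refl
    ... | no  _ = refl

  deg≡weight : ∀ H v → deg G H v ≡ weight H (incidence v)
  deg≡weight H v = Σ-cong (allFin (m G)) λ {e} _ → pointwise e
    where
    pointwise : ∀ e → (if H e ∧ (⌊ proj₁ (ends G e) ≟ v ⌋ ∨ ⌊ proj₂ (ends G e) ≟ v ⌋) then 1 else 0) ≡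
                      (if H e then incidence v e else 0)
    pointwise e with H e
    ... | false = refl
    ... | true with proj₁ (ends G e) ≟ v | proj₂ (ends G e) ≟ v
    ...   | yes p | yes q = contradiction (trans p (sym q)) (loopless e)
    ...   | yes _ | no  _ = refl
    ...   | no  _ | yes _ = refl
    ...   | no  _ | no  _ = refl

  balanced : ∃ λ (T : Fin k → EdgeSet G) → IsFactorization k G T ×
    (∀ v i → WithinBound k (deg G (T i) v) (deg G (allEdges G) v))
  balanced with levels (suc k) k ≤-refl k≥1
  ... | f , cost _ 2^f≤ , level with level (allFin k) (allFin⁺ k) (length-tabulate {n = k} id) s₀
  ...   | (χ , trees) , _ , near = class χ ,
    ((λ i → proj₁ (trees i) , connected⇒acyclic (proj₁ (trees i)) (proj₂ (trees i))) ,
     (λ i j e i≢j p q → i≢j (trans (sym (class-≡ χ p)) (class-≡ χ q))) ,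
     (λ e → χ e , class-yes χ refl)) ,
    λ v i → near⇒WithinBound {f} {k} 2^f≤ (subst₂ (Near f k)
      (trans (S-total (χ , trees) v) (sym (deg≡weight (allEdges G) v)))
      (sym (deg≡weight (class χ i) v))
      (subst (λ l → Near f l (S (χ , trees) (allFin k) v) (d (χ , trees) i v)) (length-tabulate {n = k} id)
        (near (∈-allFin i) v)))

theorem4 : (k : ℕ) → k ≥ 1 → (G : Graph) → MultipleTree k G →
    ∃ λ (T : Fin k → EdgeSet G) → IsFactorization k G T ×
    (∀ (v : Fin (n G)) (i : Fin k) →
    WithinBound k (deg G (T i) v) (deg G (allEdges G) v))
theorem4 k k≥1 G (T , fact) with inhabited? (n G)
... | inj₁ v₀ = Factorization.balanced k k≥1 G T fact v₀
-- Without vertices there is nothing to bound; this case is apart because a tree has n - 1 edges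
-- only if there is a vertex.
... | inj₂ no-vertex = T , fact , λ v → contradiction v no-vertex
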